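{- For all integers $s\ge 1$ and $t\ge 2$, $$\chi_s(W(s,t))=t+2(s-1).$$
   Context: Graphs are finite, simple and undirected. For positive integers $s,t$ the graph $W(s,t)$ has vertex set consisting of all sequences $(x_1,\dots,x_t)$ with $x_i\in\{0,1,\dots,s\}$ for all $i$, such that there is exactly one index $i$ with $x_i=0$ and at least one index $j$ with $x_j=1$. Two vertices $(x_1,\dots,x_t)$ and $(y_1,\dots,y_t)$ are adjacent if and only if for every $i$ either $|x_i-y_i|=1$ or $x_i=y_i=s$. For a graph $G$ and a positive integer $r$, the $r$-fold chromatic number ($r$-th multichromatic number) $\chi_r(G)$ is the minimum $n$ such that one can assign to each vertex of $G$ a set of exactly $r$ distinct colors from $\{1,\dots,n\}$ in such a way that adjacent vertices receive disjoint sets. (Equivalently, $G$ admits a homomorphism to the Kneser graph whose vertices are the $r$-element subsets of $\{1,\dots,n\}$, two being adjacent if and only if they are disjoint.) -}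

module Defs where

open import Data.Empty using (⊥; ⊥-elim-irr)
open import Data.Fin using (Fin; toℕ)
import Data.Fin.Properties as Fin
open import Data.Fin.Subset using (Subset; ∣_∣; _∩_; Empty)
open import Data.Irrelevant using ([_])
open import Data.List using (List; []; _∷_; allFin; cartesianProductWith)
open import Data.List.Membership.Propositional using (_∈_)
open import Data.List.Membership.Propositional.Properties
  using (∈-allFin; ∈-cartesianProductWith⁺)
open import Data.List.Relation.Unary.Any using (here; there)
open import Data.List.Relation.Unary.Enumerates.Setoid using (IsEnumeration)
open import Data.Nat using (ℕ; zero; suc; _≤_; NonZero; ≢-nonZero⁻¹; ∣_-_∣)
import Data.Nat.Properties as ℕ
open import Data.Product using (∃; ∃!; _×_; _,_; Σ-syntax)
open import Data.Refinement using (Refinement; _,_; value)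
open import Data.Sum using (_⊎_; inj₁; inj₂)
import Data.Sum as Sum
open import Data.Vec using (Vec; []; _∷_; lookup)
open import Relation.Binary using (Rel; Symmetric; Irreflexive)
open import Relation.Binary.PropositionalEquality
  using (_≡_; refl; sym; trans; setoid)
open import Relation.Nullary using (yes; no)
open import Relation.Nullary.Decidable using (map′; _×-dec_; _→-dec_)
open import Relation.Unary using (Pred; Decidable)
open import Level using (0ℓ)

record Graph : Set₁ where
  infix 4 _~_
  field
    Vertex : Set
    _~_    : Rel Vertex 0ℓ
    ~-sym  : Symmetric _~_
    ~-irr  : Irreflexive _≡_ _~_
    finite : ∃ (IsEnumeration (setoid Vertex))

Colorable : ℕ → Graph → ℕ → Set
Colorable r G n =
  Σ[ c ∈ (Vertex → Subset n) ]
    (∀ v → ∣ c v ∣ ≡ r) × (∀ u v → u ~ v → Empty (c u ∩ c v))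
  where open Graph G

-- χ_r(G) = n, with the minimum stated as a relation between r, G and n.
IsMultichromaticNumber : ℕ → Graph → ℕ → Set
IsMultichromaticNumber r G n =
  Colorable r G n × (∀ m → Colorable r G m → n ≤ m)

private
  module _ {A : Set} {P : Pred A 0ℓ} (P? : Decidable P) where

    refinements : List A → List (Refinement A P)
    refinements []       = []
    refinements (x ∷ xs) with P? x
    ... | yes p = (x , [ p ]) ∷ refinements xs
    ... | no  _ = refinements xs

    ∈-refinements : ∀ {xs} (v : Refinement A P) →
                    value v ∈ xs → v ∈ refinements xs
    ∈-refinements {x ∷ xs} (_ , [ p ]) (here refl) with P? x
    ... | yes _  = here refl
    ... | no  ¬p = ⊥-elim-irr (¬p p)
    ∈-refinements {x ∷ xs} v (there v∈xs) with P? x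
    ... | yes _ = there (∈-refinements v v∈xs)
    ... | no  _ = ∈-refinements v v∈xs

  allVecs : ∀ m t → List (Vec (Fin m) t)
  allVecs m zero    = [] ∷ []
  allVecs m (suc t) = cartesianProductWith _∷_ (allFin m) (allVecs m t)

  ∈-allVecs : ∀ {m t} (x : Vec (Fin m) t) → x ∈ allVecs m t
  ∈-allVecs []       = here refl
  ∈-allVecs (a ∷ x) =
    ∈-cartesianProductWith⁺ _∷_ (∈-allFin a) (∈-allVecs x)

module _ (s t : ℕ) where

  Sequence : Set
  Sequence = Vec (Fin (suc s)) t

  entry : Sequence → Fin t → ℕ
  entry x i = toℕ (lookup x i)

  IsVertex : Pred Sequence 0ℓ
  IsVertex x = ∃! _≡_ (λ i → entry x i ≡ 0) × ∃ (λ j → entry x j ≡ 1)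

  Adjacent : Rel Sequence 0ℓ
  Adjacent x y = ∀ i →
    ∣ entry x i - entry y i ∣ ≡ 1 ⊎ (entry x i ≡ s × entry y i ≡ s)

  isVertex? : Decidable IsVertex
  isVertex? x =
    Fin.any? (λ i → (entry x i ℕ.≟ 0) ×-dec
      map′ (λ f {j} → f j) (λ f j → f {j})
        (Fin.all? (λ j → (entry x j ℕ.≟ 0) →-dec (i Fin.≟ j))))
    ×-dec Fin.any? (λ j → entry x j ℕ.≟ 1)

  Adjacent-sym : Symmetric Adjacent
  Adjacent-sym {x} {y} x~y i =
    Sum.map (trans (ℕ.∣-∣-comm (entry y i) (entry x i)))
            (λ (xᵢ≡s , yᵢ≡s) → yᵢ≡s , xᵢ≡s) (x~y i)

  Adjacent-irr : .{{_ : NonZero s}} → ∀ x → IsVertex x → Adjacent x x → ⊥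
  Adjacent-irr x ((i , xᵢ≡0 , _) , _) x~x with x~x i
  ... | inj₂ (xᵢ≡s , _) = ≢-nonZero⁻¹ s (trans (sym xᵢ≡s) xᵢ≡0)
  ... | inj₁ eq with () ← trans (sym (ℕ.∣n-n∣≡0 (entry x i))) eq

  -- A vertex is a sequence together with an irrelevant proof of IsVertex, so
  -- that equal sequences are equal vertices.
  W : .{{NonZero s}} → Graph
  W = record
    { Vertex = Refinement Sequence IsVertex
    ; _~_    = λ u v → Adjacent (value u) (value v)
    ; ~-sym  = λ {u} {v} → Adjacent-sym {value u} {value v}
    ; ~-irr  = λ { {x , [ p ]} refl x~x → ⊥-elim-irr (Adjacent-irr x p x~x) }
    ; finite = refinements isVertex? (allVecs (suc s) t)
             , λ v → ∈-refinements isVertex? v (∈-allVecs (value v))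
    }

{-# OPTIONS --safe #-}

-- Upper bound: at level l = 0, …, s − 1 let k be the position of the first
-- entry that is at most l. A vertex gets the colour k − l if this entry has the
-- parity of l, and an extra colour reserved for level l ≥ 1 otherwise.
--
-- Lower bound: deleting two colours from [n] maps disjoint r-sets to disjoint
-- (r − 1)-sets (Stahl), so it is enough that W(s,t) is not (t − 1)-colourable.
-- This is topological: the signed vertices of W(s,t) carry a symmetric cycle
-- over 𝔽₂ whose simplices, of dimension t − 2, span bicliques. The cycle for
-- t + 1 is the suspension of the cycle for t, where a hemisphere P is made of
-- prisms that move the two sides alternately until one of them collapses to an
-- apex. Ky Fan's count α of alternating simplices satisfies δα = α + να, where ν
-- exchanges the signs, so that α(P + νP) = α(∂P) is the count one dimension
-- lower, and it is always odd.
module Submission where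

open import Defs
open import Data.Nat using (ℕ; _+_; _*_; _∸_; _≥_; NonZero)
open import Data.Nat
  using (zero; suc; _≤_; _<_; _≤?_; _⊓_; _⊔_; z≤n; s≤s; s≤s⁻¹; ∣_-_∣)
import Data.Nat.Properties as ℕ
open import Algebra.Properties.CommutativeSemigroup ℕ.+-commutativeSemigroup using (interchange)
open import Data.Bool using (Bool; true; false; not; _xor_; _∧_)
import Data.Bool.Properties as Bool
open import Data.Bool.Solver using (module xor-∧-Solver)
open import Data.Fin using (Fin; zero; suc; toℕ; fromℕ<)
import Data.Fin.Properties as Fin
open import Data.Fin.Subset
  using (Subset; inside; outside; ∣_∣; ⁅_⁆; _∪_; _∩_; Empty; Nonempty)
  renaming (_∈_ to _∈ˢ_; _∉_ to _∉ˢ_; ⊥ to ∅)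
import Data.Fin.Subset.Properties as Subset
open import Data.Irrelevant using ([_])
open import Data.List using (List; []; _∷_; _++_; map; length; concatMap)
import Data.List.Properties as List
open import Data.List.Membership.Propositional using (_∈_)
open import Data.List.Membership.Propositional.Properties
  using (∈-map⁺; ∈-map⁻; ∈-++⁺ˡ; ∈-++⁺ʳ; ∈-++⁻)
open import Data.List.Relation.Unary.All as All using (All; []; _∷_)
import Data.List.Relation.Unary.All.Properties as All
open import Data.List.Relation.Unary.AllPairs using (AllPairs; []; _∷_)
open import Data.List.Relation.Unary.Any using (here; there)
open import Data.Product using (∃; Σ-syntax; _×_; _,_; proj₁; proj₂)
open import Data.Refinement using (_,_; value)
open import Data.Sum using (_⊎_; inj₁; inj₂)
import Data.Sum as Sum
open import Data.Vec using (Vec; []; _∷_; here; there; lookup)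
import Data.Vec as Vec
import Data.Vec.Properties as Vec
open import Function using (_∘_)
open import Relation.Binary using (tri<; tri≈; tri>)
open import Relation.Binary.PropositionalEquality
  using (_≡_; _≢_; refl; sym; trans; cong; cong₂; subst; subst₂; module ≡-Reasoning)
open import Relation.Nullary using (¬_; yes; no; contradiction)
open import Relation.Nullary.Decidable using (recompute)

open xor-∧-Solver using (solve; _:=_; _:+_; con)

-- Parity and closeness of entries.

odd : ℕ → Bool
odd zero    = false
odd (suc n) = not (odd n)

Close : ℕ → ℕ → ℕ → Set
Close s a b = ∣ a - b ∣ ≡ 1 ⊎ (a ≡ s × b ≡ s)

close-sym : ∀ {s a b} → Close s a b → Close s b a
close-sym {a = a} {b} (inj₁ e)       = inj₁ (trans (ℕ.∣-∣-comm b a) e)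
close-sym             (inj₂ (p , q)) = inj₂ (q , p)

odd-distance-1 : ∀ a b → ∣ a - b ∣ ≡ 1 → odd a ≢ odd b
odd-distance-1 zero    (suc zero)    refl ()
odd-distance-1 (suc zero)    zero    refl ()
odd-distance-1 (suc a) (suc b) e eq = odd-distance-1 a b e (Bool.not-injective eq)

close⇒odd≢ : ∀ {s a b} → Close s a b → a < s → odd a ≢ odd b
close⇒odd≢ {a = a} {b} (inj₁ e) _ = odd-distance-1 a b e
close⇒odd≢ (inj₂ (refl , _)) a<s  = contradiction a<s (ℕ.<-irrefl refl)

gap⇒¬close : ∀ {s a b} → suc a < b → ¬ Close s a b
gap⇒¬close {a = a} {b} gap (inj₁ e) = ℕ.<⇒≱ gap
  (subst (b ≤_) (trans (cong (a +_) e) (ℕ.+-comm a 1)) (ℕ.m≤n+∣n-m∣ b a))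
gap⇒¬close gap (inj₂ (refl , refl)) = ℕ.<⇒≱ gap (ℕ.n≤1+n _)

≢⇒≡ : ∀ {a b c : Bool} → a ≢ c → b ≢ c → a ≡ b
≢⇒≡ a≢c b≢c = trans (Bool.¬-not a≢c) (sym (Bool.¬-not b≢c))

-- Upper bound: one colour for each level.

First : ∀ {t} → (Fin t → ℕ) → ℕ → Fin t → Set
First f l k = f k ≤ l × (∀ j → toℕ j < toℕ k → l < f j)

first : ∀ {t} (f : Fin t → ℕ) l → (∃ λ i → f i ≤ l) → ∃ (First f l)
first {suc t} f l _ with f zero ℕ.≤? l
first {suc t} f l _ | yes f0≤l = zero , f0≤l , λ _ ()
first {suc t} f l (zero  , f0≤l) | no f0≰l = contradiction f0≤l f0≰l
first {suc t} f l (suc i , fi≤l) | no f0≰l with first (f ∘ suc) l (i , fi≤l)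
... | k , fk≤l , before = suc k , fk≤l , λ where
  zero    _         → ℕ.≰⇒> f0≰l
  (suc j) (s≤s j<k) → before j j<k

-- The colour of a vertex at level l is (r ∸ l) + κ, where s = 1 + r and κ is
-- the position k of the first entry that is at most l if this entry has the
-- parity of l, and the out-of-range value t + r otherwise.
data Key (r : ℕ) {t} (f : Fin t → ℕ) (l : ℕ) : ℕ → Set where
  same : ∀ k → First f l k → odd (f k) ≡ odd l → Key r f l (toℕ k)
  diff : ∀ k → First f l k → odd (f k) ≢ odd l → Key r f l (t + r)

module _ {r t : ℕ} where

  key : ∀ {f : Fin t → ℕ} → (∃ λ i → f i ≡ 0) → ∀ l → ∃ (Key r f l)
  key {f} (i , fi≡0) l
    with first f l (i , subst (_≤ l) (sym fi≡0) z≤n)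
  ... | k , first-k with odd (f k) Bool.≟ odd l
  ...   | yes p = toℕ k , same k first-k p
  ...   | no ¬p = t + r , diff k first-k ¬p

  even-colour< : ∀ l (k : Fin t) → (r ∸ l) + toℕ k < t + r
  even-colour< l k = subst ((r ∸ l) + toℕ k <_) (ℕ.+-comm r t)
    (ℕ.+-mono-≤-< (ℕ.m∸n≤m r l) (Fin.toℕ<n k))

  even≢odd-colour : ∀ l m (k : Fin t) → (r ∸ l) + toℕ k ≢ (r ∸ m) + (t + r)
  even≢odd-colour l m k = ℕ.<⇒≢ (ℕ.<-≤-trans (even-colour< l k) (ℕ.m≤n+m (t + r) (r ∸ m)))

  colour-bound : ∀ {f : Fin t → ℕ} {l κ} → l ≤ r → Key r f l κ →
                 (r ∸ l) + κ < t + 2 * r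
  colour-bound {l = l} l≤r (same k _ _) = ℕ.<-≤-trans (even-colour< l k)
    (ℕ.+-monoʳ-≤ t (ℕ.m≤m+n r (r + 0)))
  -- An entry that is at most 0 has the parity of level 0, so level 0 needs no extra colour; such a
  -- colour would be `t + 2 * r` itself, one too many.
  colour-bound {f} {zero} l≤r (diff k (fk≤0 , _) p) =
    contradiction (cong odd (ℕ.n≤0⇒n≡0 fk≤0)) p
  colour-bound {l = suc l} l<r (diff _ _ _) = begin-strict
    (r ∸ suc l) + (t + r) <⟨ ℕ.+-monoˡ-< (t + r) (ℕ.∸-monoʳ-< {r} {suc l} {0} (s≤s z≤n) l<r) ⟩
    r + (t + r)           ≡⟨ ℕ.+-comm r (t + r) ⟩
    t + r + r             ≡⟨ ℕ.+-assoc t r r ⟩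
    t + (r + r)           ≡⟨ cong (λ x → t + (r + x)) (ℕ.+-identityʳ r) ⟨
    t + 2 * r             ∎
    where open ℕ.≤-Reasoning

  -- Raising the level can only move the first admissible position to the left, while `r ∸ l` drops
  -- strictly, so the regular colours strictly decrease. The extra colours are told apart by `r ∸ l`
  -- alone.
  levels-distinct : ∀ {f : Fin t → ℕ} {l m κ κ′} → l < m → m ≤ r →
    Key r f l κ → Key r f m κ′ → (r ∸ l) + κ ≢ (r ∸ m) + κ′
  levels-distinct {l = l} {m} l<m m≤r (same k (fk≤l , _) _) (same k′ (_ , before) _) =
    ℕ.>⇒≢ (ℕ.+-mono-<-≤ (ℕ.∸-monoʳ-< l<m m≤r)
      (ℕ.≮⇒≥ λ k<k′ → ℕ.<⇒≱ (ℕ.<-trans l<m (before k k<k′)) fk≤l))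
  levels-distinct {l = l} {m} l<m m≤r (same k _ _) (diff _ _ _) =
    even≢odd-colour l m k
  levels-distinct {l = l} {m} l<m m≤r (diff _ _ _) (same k′ _ _) =
    even≢odd-colour m l k′ ∘ sym
  levels-distinct {l = l} {m} l<m m≤r (diff _ _ _) (diff _ _ _) e =
    ℕ.>⇒≢ (ℕ.∸-monoʳ-< l<m m≤r) (ℕ.+-cancelʳ-≡ (t + r) (r ∸ l) (r ∸ m) e)

  -- The wrong parity puts `f k` strictly below `l`, whereas `g k` would be strictly above `l` if
  -- `k` preceded `k′`; close entries cannot be that far apart.
  odd-level-independent : ∀ {f g : Fin t → ℕ} {l k k′} →
    (∀ i → Close (suc r) (f i) (g i)) → First f l k → odd (f k) ≢ odd l →
    First g l k′ → ¬ (toℕ k < toℕ k′)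
  odd-level-independent {k = k} f~g (fk≤l , _) p (_ , before) k<k′ =
    gap⇒¬close (ℕ.≤-<-trans (ℕ.≤∧≢⇒< fk≤l (p ∘ cong odd)) (before k k<k′)) (f~g k)

  adjacent-distinct : ∀ {f g : Fin t → ℕ} {l m κ κ′} →
    (∀ i → Close (suc r) (f i) (g i)) → l ≤ m → m ≤ r →
    Key r f l κ → Key r g m κ′ → (r ∸ l) + κ ≢ (r ∸ m) + κ′
  adjacent-distinct {l = l} {m} f~g l≤m m≤r (same k _ _) (diff _ _ _) =
    even≢odd-colour l m k
  adjacent-distinct {l = l} {m} f~g l≤m m≤r (diff _ _ _) (same k′ _ _) =
    even≢odd-colour m l k′ ∘ sym
  -- At a single level, equal colours give close entries of equal parity at the same position. At
  -- different levels they force `k` before `k′`, and then `f k ≤ l` and `m < g k` are too far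
  -- apart.
  adjacent-distinct {f} {g} {l} {m} f~g l≤m m≤r
    (same k (fk≤l , _) p) (same k′ (_ , before) q) e with ℕ.m≤n⇒m<n∨m≡n l≤m
  ... | inj₂ refl = close⇒odd≢ (f~g k) (s≤s (ℕ.≤-trans fk≤l m≤r))
          (trans p (trans (sym q) (cong (odd ∘ g) (sym k≡k′))))
    where k≡k′ = Fin.toℕ-injective (ℕ.+-cancelˡ-≡ (r ∸ l) _ _ e)
  ... | inj₁ l<m = gap⇒¬close
          (ℕ.≤-<-trans (s≤s fk≤l) (ℕ.≤-<-trans l<m (before k k<k′))) (f~g k)
    where
    k<k′ : toℕ k < toℕ k′
    k<k′ = ℕ.≰⇒> λ k′≤k → ℕ.>⇒≢ (ℕ.+-mono-<-≤ (ℕ.∸-monoʳ-< l<m m≤r) k′≤k) e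
  adjacent-distinct {f} {g} {l} {m} f~g l≤m m≤r (diff k F p) (diff k′ G q) e
    with refl ← ℕ.∸-cancelˡ-≡ (ℕ.≤-trans l≤m m≤r) m≤r
                  (ℕ.+-cancelʳ-≡ (t + r) _ _ e)
    with ℕ.<-cmp (toℕ k) (toℕ k′)
  ... | tri< k<k′ _ _ = odd-level-independent f~g F p G k<k′
  ... | tri> _ _ k′<k = odd-level-independent (close-sym ∘ f~g) G q F k′<k
  ... | tri≈ _ k≡k′ _ with refl ← Fin.toℕ-injective k≡k′ =
    close⇒odd≢ (f~g k) (s≤s (ℕ.≤-trans (proj₁ F) m≤r)) (≢⇒≡ p q)

-- Colour sets and the resulting multicolouring.

∣⁅x⁆∪p∣ : ∀ {n} {x : Fin n} {p} → x ∉ˢ p → ∣ ⁅ x ⁆ ∪ p ∣ ≡ suc ∣ p ∣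
∣⁅x⁆∪p∣ {x = zero}  {inside  ∷ p} x∉p = contradiction here x∉p
∣⁅x⁆∪p∣ {x = zero}  {outside ∷ p} x∉p =
  cong (suc ∘ ∣_∣) (Subset.∪-identityˡ p)
∣⁅x⁆∪p∣ {x = suc x} {inside  ∷ p} x∉p = cong suc (∣⁅x⁆∪p∣ (x∉p ∘ there))
∣⁅x⁆∪p∣ {x = suc x} {outside ∷ p} x∉p = ∣⁅x⁆∪p∣ (x∉p ∘ there)

image : ∀ {n s} (f : Fin s → Fin n) → (∀ {i j} → f i ≡ f j → i ≡ j) →
        Σ[ p ∈ Subset n ] ∣ p ∣ ≡ s × (∀ {x} → x ∈ˢ p → ∃ λ i → f i ≡ x)
image {n} {zero}  f inj = ∅ , Subset.∣⊥∣≡0 n , λ x∈∅ → contradiction x∈∅ Subset.∉⊥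
image {n} {suc s} f inj with image (f ∘ suc) (Fin.suc-injective ∘ inj)
... | p , ∣p∣≡s , pre = ⁅ f zero ⁆ ∪ p , trans (∣⁅x⁆∪p∣ f0∉p) (cong suc ∣p∣≡s) , pre′
  where
  f0∉p : f zero ∉ˢ p
  f0∉p f0∈p with pre f0∈p
  ... | i , e with () ← inj e
  pre′ : ∀ {x} → x ∈ˢ ⁅ f zero ⁆ ∪ p → ∃ λ i → f i ≡ x
  pre′ x∈ with Subset.x∈p∪q⁻ _ _ x∈
  ... | inj₁ x∈f0 = zero , sym (Subset.x∈⁅y⁆⇒x≡y _ x∈f0)
  ... | inj₂ x∈p  = suc (proj₁ (pre x∈p)) , proj₂ (pre x∈p)

module _ (r t : ℕ) where

  private
    W′ = W (suc r) t
    open Graph W′ using (Vertex; _~_)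

    vertex-key : (v : Vertex) (l : Fin (suc r)) →
                 ∃ (Key r (entry (suc r) t (value v)) (toℕ l))
    -- The proof inside a vertex is irrelevant; decidability of `IsVertex` recovers a usable
    -- position of the zero.
    vertex-key (x , [ p ]) l with recompute (isVertex? (suc r) t x) p
    ... | (i , xi≡0 , _) , _ = key (i , xi≡0) (toℕ l)

    level≤r : (l : Fin (suc r)) → toℕ l ≤ r
    level≤r l = s≤s⁻¹ (Fin.toℕ<n l)

    colour : Vertex → Fin (suc r) → Fin (t + 2 * r)
    colour v l = fromℕ< (colour-bound (level≤r l) (proj₂ (vertex-key v l)))

    colour-toℕ : ∀ {u v l m} → colour u l ≡ colour v m →
      (r ∸ toℕ l) + proj₁ (vertex-key u l) ≡ (r ∸ toℕ m) + proj₁ (vertex-key v m)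
    colour-toℕ e = Fin.fromℕ<-injective _ _ _ _ e

    colour-injective : ∀ v {l m} → colour v l ≡ colour v m → l ≡ m
    colour-injective v {l} {m} e with ℕ.<-cmp (toℕ l) (toℕ m)
    ... | tri≈ _ l≡m _ = Fin.toℕ-injective l≡m
    ... | tri< l<m _ _ = contradiction (colour-toℕ {v} {v} {l} {m} e)
          (levels-distinct l<m (level≤r m) (proj₂ (vertex-key v l)) (proj₂ (vertex-key v m)))
    ... | tri> _ _ m<l = contradiction (sym (colour-toℕ {v} {v} {l} {m} e))
          (levels-distinct m<l (level≤r l) (proj₂ (vertex-key v m)) (proj₂ (vertex-key v l)))

    colour-proper : ∀ u v l m → u ~ v → colour u l ≢ colour v m
    colour-proper u v l m u~v e with ℕ.≤-total (toℕ l) (toℕ m)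
    ... | inj₁ l≤m = adjacent-distinct u~v l≤m (level≤r m)
          (proj₂ (vertex-key u l)) (proj₂ (vertex-key v m)) (colour-toℕ {u} {v} {l} {m} e)
    ... | inj₂ m≤l = adjacent-distinct (close-sym ∘ u~v) m≤l (level≤r l)
          (proj₂ (vertex-key v m)) (proj₂ (vertex-key u l)) (sym (colour-toℕ {u} {v} {l} {m} e))

  W-colorable : Colorable (suc r) W′ (t + 2 * r)
  W-colorable =
      (λ v → proj₁ (palette v))
    , (λ v → proj₁ (proj₂ (palette v)))
    , λ u v u~v → λ (_ , x∈) →
        let x∈u , x∈v = Subset.x∈p∩q⁻ (proj₁ (palette u)) (proj₁ (palette v)) x∈
            l , eu = proj₂ (proj₂ (palette u)) x∈u
            m , ev = proj₂ (proj₂ (palette v)) x∈v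
        in colour-proper u v l m u~v (trans eu (sym ev))
    where palette = λ v → image (colour v) (λ {i} {j} → colour-injective v {i} {j})

-- Stahl's reduction.

addFirst removeFirst : ∀ {n} → Subset n → Subset n
addFirst []            = []
addFirst (outside ∷ p) = inside ∷ p
addFirst (inside  ∷ p) = inside ∷ addFirst p
removeFirst []            = []
removeFirst (inside  ∷ p) = outside ∷ p
removeFirst (outside ∷ p) = outside ∷ removeFirst p

∣addFirst∣ : ∀ {n} (p : Subset n) → ∣ p ∣ < n → ∣ addFirst p ∣ ≡ suc ∣ p ∣
∣addFirst∣ (outside ∷ p) _       = refl
∣addFirst∣ (inside  ∷ p) (s≤s h) = cong suc (∣addFirst∣ p h)

∣removeFirst∣ : ∀ {n k} (p : Subset n) → ∣ p ∣ ≡ suc k → ∣ removeFirst p ∣ ≡ k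
∣removeFirst∣ (inside  ∷ p) e = ℕ.suc-injective e
∣removeFirst∣ (outside ∷ p) e = ∣removeFirst∣ p e

removeFirst-⊆ : ∀ {n i} (p : Subset n) → i ∈ˢ removeFirst p → i ∈ˢ p
removeFirst-⊆ (inside  ∷ p) (there i∈) = there i∈
removeFirst-⊆ (outside ∷ p) (there i∈) = there (removeFirst-⊆ p i∈)

outside-∷-Empty : ∀ {n} {p : Subset n} → Empty p → Empty (outside ∷ p)
outside-∷-Empty ∅p (suc i , there i∈p) = ∅p (i , i∈p)

disjoint-⊆ʳ : ∀ {n} (p q q′ : Subset n) → (∀ {i} → i ∈ˢ q′ → i ∈ˢ q) →
              Empty (p ∩ q) → Empty (p ∩ q′)
disjoint-⊆ʳ p q q′ q′⊆q p∩q=∅ (i , i∈) =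
  let i∈p , i∈q′ = Subset.x∈p∩q⁻ p q′ i∈
  in p∩q=∅ (i , Subset.x∈p∩q⁺ (i∈p , q′⊆q i∈q′))

disjoint-sym : ∀ {n} (p q : Subset n) → Empty (p ∩ q) → Empty (q ∩ p)
disjoint-sym p q = subst Empty (Subset.∩-comm p q)

-- The element that addFirst adds to p is removed from q if it lies in q, as
-- every smaller element lies in p and hence not in q.
addFirst-removeFirst-disjoint : ∀ {n} (p q : Subset n) →
  Empty (p ∩ q) → Empty (addFirst p ∩ removeFirst q)
addFirst-removeFirst-disjoint [] [] h = h
addFirst-removeFirst-disjoint (inside ∷ p) (inside ∷ q) h =
  contradiction (zero , here) h
addFirst-removeFirst-disjoint (inside ∷ p) (outside ∷ q) h =
  outside-∷-Empty (addFirst-removeFirst-disjoint p q (Subset.drop-∷-Empty h))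
addFirst-removeFirst-disjoint (outside ∷ p) (inside ∷ q) h =
  outside-∷-Empty (Subset.drop-∷-Empty h)
addFirst-removeFirst-disjoint (outside ∷ p) (outside ∷ q) h =
  outside-∷-Empty (disjoint-⊆ʳ p q (removeFirst q) (removeFirst-⊆ q)
    (Subset.drop-∷-Empty h))

-- Each set has to lose exactly one element in total: a set with both deleted colours is given one
-- back, a set with neither gives one up. If one of two disjoint sets contains both colours, the
-- other contains neither, so `addFirst` only ever meets `removeFirst`.
reduce : ∀ {n} → Subset (2 + n) → Subset n
reduce (inside  ∷ inside  ∷ p) = addFirst p
reduce (inside  ∷ outside ∷ p) = p
reduce (outside ∷ inside  ∷ p) = p
reduce (outside ∷ outside ∷ p) = removeFirst p

∣reduce∣ : ∀ {n r} (p : Subset (2 + n)) → r < n → ∣ p ∣ ≡ 2 + r → ∣ reduce p ∣ ≡ suc r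
∣reduce∣ (inside ∷ inside ∷ p) r<n e
  with refl ← ℕ.suc-injective (ℕ.suc-injective e) = ∣addFirst∣ p r<n
∣reduce∣ (inside  ∷ outside ∷ p) r<n e = ℕ.suc-injective e
∣reduce∣ (outside ∷ inside  ∷ p) r<n e = ℕ.suc-injective e
∣reduce∣ (outside ∷ outside ∷ p) r<n e = ∣removeFirst∣ p e

reduce-disjoint : ∀ {n} (p q : Subset (2 + n)) →
                  Empty (p ∩ q) → Empty (reduce p ∩ reduce q)
reduce-disjoint (inside ∷ _) (inside ∷ _) h = contradiction (zero , here) h
reduce-disjoint (_ ∷ inside ∷ _) (_ ∷ inside ∷ _) h =
  contradiction (suc zero , there here) h
reduce-disjoint (inside ∷ inside ∷ p) (outside ∷ outside ∷ q) h =
  addFirst-removeFirst-disjoint p q (Subset.drop-∷-Empty (Subset.drop-∷-Empty h))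
reduce-disjoint (outside ∷ outside ∷ p) (inside ∷ inside ∷ q) h =
  disjoint-sym (addFirst q) (removeFirst p) (addFirst-removeFirst-disjoint q p
    (disjoint-sym p q (Subset.drop-∷-Empty (Subset.drop-∷-Empty h))))
reduce-disjoint (inside ∷ outside ∷ p) (outside ∷ inside ∷ q) h =
  Subset.drop-∷-Empty (Subset.drop-∷-Empty h)
reduce-disjoint (outside ∷ inside ∷ p) (inside ∷ outside ∷ q) h =
  Subset.drop-∷-Empty (Subset.drop-∷-Empty h)
reduce-disjoint (inside ∷ outside ∷ p) (outside ∷ outside ∷ q) h =
  disjoint-⊆ʳ p q (removeFirst q) (removeFirst-⊆ q)
    (Subset.drop-∷-Empty (Subset.drop-∷-Empty h))
reduce-disjoint (outside ∷ inside ∷ p) (outside ∷ outside ∷ q) h =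
  disjoint-⊆ʳ p q (removeFirst q) (removeFirst-⊆ q)
    (Subset.drop-∷-Empty (Subset.drop-∷-Empty h))
reduce-disjoint (outside ∷ outside ∷ p) (inside ∷ outside ∷ q) h =
  disjoint-sym q (removeFirst p) (disjoint-⊆ʳ q p (removeFirst p) (removeFirst-⊆ p)
    (disjoint-sym p q (Subset.drop-∷-Empty (Subset.drop-∷-Empty h))))
reduce-disjoint (outside ∷ outside ∷ p) (outside ∷ inside ∷ q) h =
  disjoint-sym q (removeFirst p) (disjoint-⊆ʳ q p (removeFirst p) (removeFirst-⊆ p)
    (disjoint-sym p q (Subset.drop-∷-Empty (Subset.drop-∷-Empty h))))
reduce-disjoint (outside ∷ outside ∷ p) (outside ∷ outside ∷ q) h =
  disjoint-⊆ʳ (removeFirst p) q (removeFirst q) (removeFirst-⊆ q)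
    (disjoint-sym q (removeFirst p) (disjoint-⊆ʳ q p (removeFirst p) (removeFirst-⊆ p)
      (disjoint-sym p q (Subset.drop-∷-Empty (Subset.drop-∷-Empty h)))))

∣disjoint∣ : ∀ {n} (p q : Subset n) → Empty (p ∩ q) → ∣ p ∣ + ∣ q ∣ ≤ n
∣disjoint∣ []            []            h = z≤n
∣disjoint∣ (inside  ∷ p) (inside  ∷ q) h = contradiction (zero , here) h
∣disjoint∣ (inside  ∷ p) (outside ∷ q) h = s≤s (∣disjoint∣ p q (Subset.drop-∷-Empty h))
∣disjoint∣ {suc n} (outside ∷ p) (inside  ∷ q) h = subst (_≤ suc n) (sym (ℕ.+-suc ∣ p ∣ ∣ q ∣))
  (s≤s (∣disjoint∣ p q (Subset.drop-∷-Empty h)))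
∣disjoint∣ (outside ∷ p) (outside ∷ q) h =
  ℕ.m≤n⇒m≤1+n (∣disjoint∣ p q (Subset.drop-∷-Empty h))

module _ (G : Graph) where
  open Graph G

  HasEdge : Set
  HasEdge = Σ[ u ∈ Vertex ] Σ[ v ∈ Vertex ] u ~ v

  edge⇒2r≤n : ∀ {r n} → HasEdge → Colorable r G n → r + r ≤ n
  edge⇒2r≤n {n = n} (u , v , u~v) (c , size , proper) =
    subst (_≤ n) (cong₂ _+_ (size u) (size v)) (∣disjoint∣ (c u) (c v) (proper u v u~v))

  stahl : ∀ {r n} → HasEdge → Colorable (2 + r) G (2 + n) → Colorable (suc r) G n
  stahl {r} {n} e C@(c , size , proper) =
      reduce ∘ c
    , (λ v → ∣reduce∣ (c v) r<n (size v))
    , λ u v u~v → reduce-disjoint (c u) (c v) (proper u v u~v)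
    where
    -- Giving an element back requires a free colour. The ends of an edge use `2 (2 + r)` distinct
    -- colours out of `2 + n`, which leaves enough room.
    r<n : r < n
    r<n = ℕ.m+n≤o⇒m≤o (suc r) (s≤s⁻¹ (subst (_≤ suc n) (cong suc (ℕ.+-suc r (suc r)))
            (s≤s⁻¹ (edge⇒2r≤n e C))))

  stahl-bound : ∀ {t} r {n} → HasEdge → (∀ {m} → Colorable 1 G m → t ≤ m) →
                Colorable (suc r) G n → t + 2 * r ≤ n
  stahl-bound {t} zero {n} e base C = subst (_≤ n) (sym (ℕ.+-identityʳ t)) (base C)
  stahl-bound {t} (suc r) {n} e base C
    -- The edge forces `3 + r ≤ n`, so there are two colours to delete.
    with n | C | ℕ.≤-trans (s≤s (ℕ.m≤n+m (2 + r) (suc r))) (edge⇒2r≤n e C)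
  ... | suc (suc n) | C | _ = begin
    t + 2 * suc r       ≡⟨ cong (t +_) (ℕ.*-suc 2 r) ⟩
    t + (2 + 2 * r)     ≡⟨ ℕ.+-suc t (suc (2 * r)) ⟩
    suc (t + (1 + 2 * r)) ≡⟨ cong suc (ℕ.+-suc t (2 * r)) ⟩
    2 + (t + 2 * r)     ≤⟨ s≤s (s≤s (stahl-bound r e base (stahl e C))) ⟩
    2 + n               ∎
    where open ℕ.≤-Reasoning
  ... | suc zero | _ | s≤s ()

-- Chains and cochains over 𝔽₂.

-- Augmented ordered simplices are lists of vertices (the empty list being the
-- simplex of dimension −1), cochains have coefficients in 𝔽₂ and chains are
-- formal sums of simplices, on which a cochain is evaluated by eval.
Cochain : Set → Set
Cochain A = List A → Bool

Chain : Set → Set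
Chain A = List (List A)

module _ {A : Set} where

  eval : Cochain A → Chain A → Bool
  eval u []      = false
  eval u (σ ∷ C) = u σ xor eval u C

  δ : Cochain A → Cochain A
  δ u []      = false
  δ u (x ∷ σ) = u σ xor δ (u ∘ (x ∷_)) σ

  eval-++ : ∀ u C D → eval u (C ++ D) ≡ eval u C xor eval u D
  eval-++ u []      D = refl
  eval-++ u (σ ∷ C) D = trans (cong (u σ xor_) (eval-++ u C D))
    (sym (Bool.xor-assoc (u σ) _ _))

  eval-xor : ∀ u v C → eval (λ σ → u σ xor v σ) C ≡ eval u C xor eval v C
  eval-xor u v []      = refl
  eval-xor u v (σ ∷ C) = trans (cong ((u σ xor v σ) xor_) (eval-xor u v C))
    (solve 4 (λ a b c d → (a :+ b) :+ (c :+ d) := (a :+ c) :+ (b :+ d)) refl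
      (u σ) (v σ) (eval u C) (eval v C))

  eval-cong : ∀ {u v : Cochain A} → (∀ σ → u σ ≡ v σ) → ∀ C → eval u C ≡ eval v C
  eval-cong u≗v []      = refl
  eval-cong u≗v (σ ∷ C) = cong₂ _xor_ (u≗v σ) (eval-cong u≗v C)

  eval-true : ∀ u C → eval u C ≡ true → ∃ λ σ → σ ∈ C × u σ ≡ true
  eval-true u (σ ∷ C) e with u σ in uσ
  ... | true  = σ , here refl , uσ
  ... | false = let τ , τ∈C , uτ = eval-true u C e in τ , there τ∈C , uτ

  -- The vertices of a face are vertices of the simplex, so agreement on lists that satisfy `P` is
  -- enough.
  δ-cong-All : ∀ {P : A → Set} {u v : Cochain A} →
    (∀ {σ} → All P σ → u σ ≡ v σ) → ∀ {σ} → All P σ → δ u σ ≡ δ v σ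
  δ-cong-All u≗v []       = refl
  δ-cong-All u≗v (p ∷ ps) = cong₂ _xor_ (u≗v ps) (δ-cong-All (u≗v ∘ (p ∷_)) ps)

  δ-cong : ∀ {u v : Cochain A} → (∀ σ → u σ ≡ v σ) → ∀ σ → δ u σ ≡ δ v σ
  δ-cong u≗v []      = refl
  δ-cong u≗v (x ∷ σ) = cong₂ _xor_ (u≗v σ) (δ-cong (u≗v ∘ (x ∷_)) σ)

  δ-xor : ∀ u v σ → δ (λ σ → u σ xor v σ) σ ≡ δ u σ xor δ v σ
  δ-xor u v []      = refl
  δ-xor u v (x ∷ σ) = trans
    (cong ((u σ xor v σ) xor_) (δ-xor (u ∘ (x ∷_)) (v ∘ (x ∷_)) σ))
    (solve 4 (λ a b c d → (a :+ b) :+ (c :+ d) := (a :+ c) :+ (b :+ d)) refl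
      (u σ) (v σ) (δ (u ∘ (x ∷_)) σ) (δ (v ∘ (x ∷_)) σ))

  δ-false : ∀ σ → δ (λ _ → false) σ ≡ false
  δ-false []      = refl
  δ-false (x ∷ σ) = δ-false σ

module _ {A B : Set} where

  eval-map : ∀ (u : Cochain B) (f : List A → List B) C →
             eval u (map f C) ≡ eval (u ∘ f) C
  eval-map u f []      = refl
  eval-map u f (σ ∷ C) = cong (u (f σ) xor_) (eval-map u f C)

  eval-concatMap : ∀ (u : Cochain B) (f : List A → Chain B) C →
                   eval u (concatMap f C) ≡ eval (eval u ∘ f) C
  eval-concatMap u f []      = refl
  eval-concatMap u f (σ ∷ C) = trans (eval-++ u (f σ) (concatMap f C))
    (cong (eval u (f σ) xor_) (eval-concatMap u f C))

  δ-map : ∀ (u : Cochain B) (f : A → B) σ → δ u (map f σ) ≡ δ (u ∘ map f) σ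
  δ-map u f []      = refl
  δ-map u f (x ∷ σ) = cong (u (map f σ) xor_) (δ-map (u ∘ (f x ∷_)) f σ)

-- Prisms, cones and cycles.

module _ {A B : Set} where

  -- The prism operator of simplicial homology, the sum of the simplices
  -- `f x₀, …, f xᵢ, g xᵢ, …, g xₙ`.
  prism : (f g : A → B) → List A → Chain B
  prism f g []      = []
  prism f g (x ∷ σ) = (f x ∷ g x ∷ map g σ) ∷ map (f x ∷_) (prism f g σ)

  -- The identity ∂P + P∂ = f + g, paired with a cochain. Induction splits off the first vertex and
  -- applies the hypothesis to `ux`, which sees the simplices that start with `f x`; the remaining
  -- terms cancel in pairs.
  prism-homotopy : ∀ f g u σ →
    eval (δ u) (prism f g σ) xor δ (eval u ∘ prism f g) σ ≡ u (map f σ) xor u (map g σ)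
  prism-homotopy f g u []      = sym (Bool.xor-same (u []))
  prism-homotopy f g u (x ∷ σ) = begin
    ((u (gx ∷ gσ) xor (u (fx ∷ gσ) xor δ uxy gσ)) xor eval (δ u) (map (fx ∷_) Pσ))
      xor (eval u Pσ xor δ (λ τ → uxy (map g τ) xor eval u (map (fx ∷_) (prism f g τ))) σ)
      ≡⟨ cong₂ (λ a b → ((u (gx ∷ gσ) xor (u (fx ∷ gσ) xor δ uxy gσ)) xor a)
                          xor (eval u Pσ xor b))
           (trans (eval-map (δ u) (fx ∷_) Pσ) (eval-xor u (δ ux) Pσ))
           (trans (δ-xor (uxy ∘ map g) _ σ) (cong₂ _xor_
             (sym (δ-map uxy g σ))
             (δ-cong (λ τ → eval-map u (fx ∷_) (prism f g τ)) σ))) ⟩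
    ((u (gx ∷ gσ) xor (u (fx ∷ gσ) xor δ uxy gσ)) xor (eval u Pσ xor eval (δ ux) Pσ))
      xor (eval u Pσ xor (δ uxy gσ xor δ (eval ux ∘ prism f g) σ))
      ≡⟨ solve 6 (λ a b c d e h →
           ((a :+ (b :+ c)) :+ (d :+ e)) :+ (d :+ (c :+ h)) := (a :+ b) :+ (e :+ h)) refl
           (u (gx ∷ gσ)) (u (fx ∷ gσ)) (δ uxy gσ) (eval u Pσ)
           (eval (δ ux) Pσ) (δ (eval ux ∘ prism f g) σ) ⟩
    (u (gx ∷ gσ) xor u (fx ∷ gσ)) xor (eval (δ ux) Pσ xor δ (eval ux ∘ prism f g) σ)
      ≡⟨ cong ((u (gx ∷ gσ) xor u (fx ∷ gσ)) xor_) (prism-homotopy f g ux σ) ⟩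
    (u (gx ∷ gσ) xor u (fx ∷ gσ)) xor (u (fx ∷ fσ) xor u (fx ∷ gσ))
      ≡⟨ solve 3 (λ a b c → (a :+ b) :+ (c :+ b) := c :+ a) refl
           (u (gx ∷ gσ)) (u (fx ∷ gσ)) (u (fx ∷ fσ)) ⟩
    u (fx ∷ fσ) xor u (gx ∷ gσ) ∎
    where
    open ≡-Reasoning
    fx  = f x
    gx  = g x
    fσ  = map f σ
    gσ  = map g σ
    Pσ  = prism f g σ
    ux  = u ∘ (fx ∷_)
    uxy = ux ∘ (gx ∷_)

  prism-All : ∀ {P : A → Set} {Q : B → Set} {f g : A → B} →
    (∀ {x} → P x → Q (f x) × Q (g x)) → ∀ {σ} → All P σ →
    All (λ τ → length τ ≡ suc (length σ) × All Q τ) (prism f g σ)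
  prism-All h [] = []
  prism-All {g = g} h {x ∷ σ} (p ∷ ps) =
      (cong (2 +_) (List.length-map g σ)
        , proj₁ (h p) ∷ proj₂ (h p) ∷ All.map⁺ (All.map (proj₂ ∘ h) ps))
    ∷ All.map⁺ (All.map (λ (e , qs) → cong suc e , proj₁ (h p) ∷ qs) (prism-All h ps))

-- Boundaries are never formed: ∂C = D is expressed as `eval (δ u) C ≡ eval u D` for every cochain
-- `u`, here with D = 0.
IsCycle : ∀ {A} → Chain A → Set
IsCycle S = ∀ u → eval (δ u) S ≡ false

module _ {A B : Set} (S : Chain A) (cycle : IsCycle S) where

  ∂-prisms : ∀ (f g : A → B) u → eval (δ u) (concatMap (prism f g) S)
               ≡ eval u (map (map f) S) xor eval u (map (map g) S)
  ∂-prisms f g u = begin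
    eval (δ u) (concatMap (prism f g) S)    ≡⟨ eval-concatMap (δ u) (prism f g) S ⟩
    eval H S                                ≡⟨ Bool.xor-identityʳ (eval H S) ⟨
    -- The added term is the part P∂ of the homotopy, which vanishes because `S` is a cycle.
    eval H S xor false                      ≡⟨ cong (eval H S xor_) (cycle K) ⟨
    eval H S xor eval (δ K) S               ≡⟨ eval-xor H (δ K) S ⟨
    eval (λ σ → H σ xor δ K σ) S            ≡⟨ eval-cong (prism-homotopy f g u) S ⟩
    eval (λ σ → u (map f σ) xor u (map g σ)) S ≡⟨ eval-xor (u ∘ map f) (u ∘ map g) S ⟩
    eval (u ∘ map f) S xor eval (u ∘ map g) S
      ≡⟨ cong₂ _xor_ (eval-map u (map f) S) (eval-map u (map g) S) ⟨
    eval u (map (map f) S) xor eval u (map (map g) S) ∎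
    where
    open ≡-Reasoning
    H = eval (δ u) ∘ prism f g
    K = eval u ∘ prism f g

  -- The face opposite `w` is the base, and the faces through `w` add up to the cone over the
  -- boundary of `S`, which is zero.
  ∂-cone : ∀ (f : A → B) w u →
    eval (δ u) (map (λ σ → w ∷ map f σ) S) ≡ eval u (map (map f) S)
  ∂-cone f w u = begin
    eval (δ u) (map (λ σ → w ∷ map f σ) S)        ≡⟨ eval-map (δ u) (λ σ → w ∷ map f σ) S ⟩
    eval (λ σ → u (map f σ) xor δ v (map f σ)) S  ≡⟨ eval-xor (u ∘ map f) (δ v ∘ map f) S ⟩
    eval (u ∘ map f) S xor eval (δ v ∘ map f) S
      ≡⟨ cong (eval (u ∘ map f) S xor_) (trans (eval-cong (δ-map v f) S) (cycle (v ∘ map f))) ⟩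
    eval (u ∘ map f) S xor false                  ≡⟨ Bool.xor-identityʳ _ ⟩
    eval (u ∘ map f) S                            ≡⟨ eval-map u (map f) S ⟨
    eval u (map (map f) S)                        ∎
    where
    open ≡-Reasoning
    v = u ∘ (w ∷_)

-- Sorted words of labels.

-- Labels are sorted by colour only, so that sorting commutes with a change of
-- all signs.
Label : Set
Label = ℕ × Bool

insert : Label → List Label → List Label
insert x []      = x ∷ []
insert x (y ∷ τ) with proj₁ x ≤? proj₁ y
... | yes _ = x ∷ y ∷ τ
... | no  _ = y ∷ insert x τ

sort : List Label → List Label
sort []      = []
sort (x ∷ σ) = insert x (sort σ)

_≼_ : Label → Label → Set
x ≼ y = proj₁ x ≤ proj₁ y

All-insert : ∀ {P : Label → Set} {x} → P x → ∀ {τ} → All P τ → All P (insert x τ)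
All-insert p [] = p ∷ []
All-insert {x = x} p {y ∷ τ} (q ∷ qs) with proj₁ x ≤? proj₁ y
... | yes _ = p ∷ q ∷ qs
... | no  _ = q ∷ All-insert p qs

All-sort : ∀ {P : Label → Set} {σ} → All P σ → All P (sort σ)
All-sort []       = []
All-sort (p ∷ ps) = All-insert p (All-sort ps)

insert-sorted : ∀ x {τ} → AllPairs _≼_ τ → AllPairs _≼_ (insert x τ)
insert-sorted x [] = [] ∷ []
insert-sorted x {y ∷ τ} (y≼τ ∷ sorted) with proj₁ x ≤? proj₁ y
... | yes x≼y = (x≼y ∷ All.map (ℕ.≤-trans x≼y) y≼τ) ∷ y≼τ ∷ sorted
... | no  x⋠y = All-insert (ℕ.≰⇒≥ x⋠y) y≼τ ∷ insert-sorted x sorted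

sort-sorted : ∀ σ → AllPairs _≼_ (sort σ)
sort-sorted []      = []
sort-sorted (x ∷ σ) = insert-sorted x (sort-sorted σ)

length-insert : ∀ x τ → length (insert x τ) ≡ suc (length τ)
length-insert x []      = refl
length-insert x (y ∷ τ) with proj₁ x ≤? proj₁ y
... | yes _ = refl
... | no  _ = cong suc (length-insert x τ)

length-sort : ∀ σ → length (sort σ) ≡ length σ
length-sort []      = refl
length-sort (x ∷ σ) = trans (length-insert x (sort σ)) (cong suc (length-sort σ))

insert-least : ∀ x {τ} → All (x ≼_) τ → insert x τ ≡ x ∷ τ
insert-least x []                  = refl
insert-least x {y ∷ τ} (x≼y ∷ x≼τ) with proj₁ x ≤? proj₁ y
... | yes _   = refl
... | no  x⋠y = contradiction x≼y x⋠y

insert-greater : ∀ x y τ → proj₁ y < proj₁ x → insert x (y ∷ τ) ≡ y ∷ insert x τ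
insert-greater x y τ y<x with proj₁ x ≤? proj₁ y
... | yes x≼y = contradiction x≼y (ℕ.<⇒≱ y<x)
... | no  _   = refl

-- Deleting `x` gives `τ` back; deleting any other letter commutes with the insertion, because `τ`
-- is sorted.
δ-insert : ∀ u x {τ} → AllPairs _≼_ τ →
           δ u (insert x τ) ≡ u τ xor δ (u ∘ insert x) τ
δ-insert u x [] = refl
δ-insert u x {y ∷ τ} (y≼τ ∷ sorted) with ℕ.≤-<-connex (proj₁ x) (proj₁ y)
... | inj₁ x≼y = trans (cong (δ u) (insert-least x x≼yτ)) (cong (u (y ∷ τ) xor_)
      (δ-cong-All (λ x≼σ → cong u (sym (insert-least x x≼σ))) x≼yτ))
  where x≼yτ = x≼y ∷ All.map (ℕ.≤-trans x≼y) y≼τ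
... | inj₂ y<x = begin
  δ u (insert x (y ∷ τ))
    ≡⟨ cong (δ u) (insert-greater x y τ y<x) ⟩
  u (insert x τ) xor δ (u ∘ (y ∷_)) (insert x τ)
    ≡⟨ cong (u (insert x τ) xor_) (δ-insert (u ∘ (y ∷_)) x sorted) ⟩
  u (insert x τ) xor (u (y ∷ τ) xor δ (u ∘ (y ∷_) ∘ insert x) τ)
    ≡⟨ cong (λ z → u (insert x τ) xor (u (y ∷ τ) xor z))
         (δ-cong (λ σ → cong u (sym (insert-greater x y σ y<x))) τ) ⟩
  u (insert x τ) xor (u (y ∷ τ) xor δ (u ∘ insert x ∘ (y ∷_)) τ)
    ≡⟨ solve 3 (λ a b c → a :+ (b :+ c) := b :+ (a :+ c)) refl
         (u (insert x τ)) (u (y ∷ τ)) (δ (u ∘ insert x ∘ (y ∷_)) τ) ⟩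
  u (y ∷ τ) xor (u (insert x τ) xor δ (u ∘ insert x ∘ (y ∷_)) τ) ∎
  where open ≡-Reasoning

-- Over 𝔽₂ a permutation of the vertices carries no sign, so sorting is compatible with taking
-- faces.
δ-sort : ∀ u σ → δ (u ∘ sort) σ ≡ δ u (sort σ)
δ-sort u []      = refl
δ-sort u (x ∷ σ) = trans
  (cong (u (sort σ) xor_) (δ-sort (u ∘ insert x) σ))
  (sym (δ-insert u x (sort-sorted σ)))

-- Alternating words and Fan's identity.

alt : Bool → Cochain Label
alt ε []            = true
alt ε ((_ , η) ∷ τ) = not (ε xor η) ∧ alt (not ε) τ

-- A nonempty alternating word has exactly one alternating face that starts with `ε`: the last
-- letter is deleted if the word starts with `ε`, the first one otherwise. In any other word such
-- faces come in pairs, by deleting either of two equal neighbours.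
δ-alt : ∀ ε τ → δ (alt ε) τ ≡ alt ε τ xor alt (not ε) τ
δ-alt ε []                    = refl
δ-alt true  ((_ , true) ∷ τ)  = trans
  (cong (alt true τ xor_) (δ-alt false τ))
  (solve 2 (λ a b → a :+ (b :+ a) := b :+ con false) refl (alt true τ) (alt false τ))
δ-alt true  ((_ , false) ∷ τ) = trans
  (cong (alt true τ xor_) (δ-false τ)) (Bool.xor-identityʳ _)
δ-alt false ((_ , true) ∷ τ)  = trans
  (cong (alt false τ xor_) (δ-false τ)) (Bool.xor-identityʳ _)
δ-alt false ((_ , false) ∷ τ) = trans
  (cong (alt false τ xor_) (δ-alt true τ))
  (solve 2 (λ a b → a :+ (b :+ a) := b :+ con false) refl (alt false τ) (alt true τ))

flip : Label → Label
flip (c , η) = c , not η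

insert-flip : ∀ x τ → insert (flip x) (map flip τ) ≡ map flip (insert x τ)
insert-flip x []      = refl
insert-flip x (y ∷ τ) with proj₁ x ≤? proj₁ y
... | yes _ = refl
... | no  _ = cong (flip y ∷_) (insert-flip x τ)

sort-flip : ∀ σ → sort (map flip σ) ≡ map flip (sort σ)
sort-flip []      = refl
sort-flip (x ∷ σ) = trans (cong (insert (flip x)) (sort-flip σ)) (insert-flip x (sort σ))

alt-flip : ∀ ε τ → alt ε (map flip τ) ≡ alt (not ε) τ
alt-flip ε []            = refl
alt-flip ε ((_ , η) ∷ τ) = cong₂ (λ a b → not a ∧ b)
  (trans (sym (Bool.not-distribʳ-xor ε η)) (Bool.not-distribˡ-xor ε η)) (alt-flip (not ε) τ)

module _ {X : Set} where

  negate : Bool × X → Bool × X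
  negate (ε , x) = not ε , x

  -- The parity of the colour is added to the sign, so that a simplex with
  -- consecutive colours alternates if it lies on one side.
  label : (X → ℕ) → Bool × X → Label
  label c (ε , x) = c x , odd (c x) xor ε

  fan : (X → ℕ) → Bool → Cochain (Bool × X)
  fan c ε σ = alt ε (sort (map (label c) σ))

  fan-negate : ∀ c ε σ → fan c ε (map negate σ) ≡ fan c (not ε) σ
  fan-negate c ε σ = begin
    alt ε (sort (map (label c) (map negate σ)))
      ≡⟨ cong (alt ε ∘ sort) (trans (sym (List.map-∘ σ)) (trans
           (List.map-cong (λ (η , x) → cong (c x ,_) (sym (Bool.not-distribʳ-xor (odd (c x)) η))) σ)
           (List.map-∘ σ))) ⟩
    alt ε (sort (map flip (map (label c) σ))) ≡⟨ cong (alt ε) (sort-flip (map (label c) σ)) ⟩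
    alt ε (map flip (sort (map (label c) σ))) ≡⟨ alt-flip ε (sort (map (label c) σ)) ⟩
    fan c (not ε) σ                           ∎
    where open ≡-Reasoning

  δ-fan : ∀ c ε σ → δ (fan c ε) σ ≡ fan c ε σ xor fan c ε (map negate σ)
  δ-fan c ε σ = begin
    δ (alt ε ∘ sort ∘ map (label c)) σ    ≡⟨ δ-map (alt ε ∘ sort) (label c) σ ⟨
    δ (alt ε ∘ sort) (map (label c) σ)    ≡⟨ δ-sort (alt ε) (map (label c) σ) ⟩
    δ (alt ε) (sort (map (label c) σ))    ≡⟨ δ-alt ε (sort (map (label c) σ)) ⟩
    fan c ε σ xor fan c (not ε) σ         ≡⟨ cong (fan c ε σ xor_) (fan-negate c ε σ) ⟨
    fan c ε σ xor fan c ε (map negate σ)  ∎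
    where open ≡-Reasoning

-- Colours of an alternating word.

not-xor⇒≡ : ∀ ε η {b} → not (ε xor η) ∧ b ≡ true → η ≡ ε × b ≡ true
not-xor⇒≡ true  true  e = refl , e
not-xor⇒≡ false false e = refl , e

-- The absence of complementary edges in Fan's lemma; it turns a change of sign into a change of
-- colour.
Consistent : List Label → Set
Consistent τ = ∀ {c ε η} → (c , ε) ∈ τ → (c , η) ∈ τ → ε ≡ η

alternating-tail-greater : ∀ {c ε η} {τ} → η ≡ ε → Consistent ((c , η) ∷ τ) →
  alt (not ε) τ ≡ true → AllPairs _≼_ ((c , η) ∷ τ) → All (λ x → c < proj₁ x) τ
alternating-tail-greater {τ = []} _ _ _ _ = []
alternating-tail-greater {c} {ε} {τ = (d , η′) ∷ τ} refl cons a ((c≤d ∷ c≼τ) ∷ (d≼τ ∷ _)) =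
  c<d ∷ All.map (ℕ.<-≤-trans c<d) d≼τ
  where
  c<d : c < d
  c<d = ℕ.≤∧≢⇒< c≤d λ { refl → Bool.not-¬ refl (trans
    (cons (here refl) (there (here refl)))
    (proj₁ (not-xor⇒≡ (not ε) η′ a))) }

-- The colours increase strictly within the interval from `k` to `N - 1`.
alternating-bound : ∀ {N} k ε τ → Consistent τ → alt ε τ ≡ true → AllPairs _≼_ τ →
  All (λ x → k ≤ proj₁ x × proj₁ x < N) τ → k ≤ N → k + length τ ≤ N
alternating-bound {N} k ε [] _ _ _ _ k≤N = subst (_≤ N) (sym (ℕ.+-identityʳ k)) k≤N
alternating-bound {N} k ε ((c , η) ∷ τ) cons a sorted@(_ ∷ sorted′) ((k≤c , c<N) ∷ bounds) _
  with refl , a′ ← not-xor⇒≡ ε η a =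
  ℕ.≤-trans
    (subst (_≤ suc c + length τ) (sym (ℕ.+-suc k (length τ))) (ℕ.+-monoˡ-≤ (length τ) (s≤s k≤c)))
    (alternating-bound (suc c) (not ε) τ (λ p q → cons (there p) (there q)) a′ sorted′
      (All.zipWith (λ (c<d , _ , d<N) → c<d , d<N) (alternating-tail-greater refl cons a′ sorted , bounds))
      c<N)

-- A word of maximal length runs through the colours one after another, so the sign of each letter
-- is tied to the parity of its colour.
all-colours : ∀ {N} k τ → Consistent τ → alt (not (odd k)) τ ≡ true → AllPairs _≼_ τ →
  All (λ x → k ≤ proj₁ x × proj₁ x < N) τ → N ≤ k + length τ →
  ∀ j → k ≤ j → j < N → (j , not (odd j)) ∈ τ
all-colours {N} k [] _ _ _ _ N≤ j k≤j j<N =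
  contradiction (ℕ.≤-trans j<N (subst (N ≤_) (ℕ.+-identityʳ k) N≤)) (ℕ.≤⇒≯ k≤j)
all-colours {N} k ((c , η) ∷ τ) cons a sorted@(_ ∷ sorted′) ((k≤c , c<N) ∷ bounds) N≤ j k≤j j<N
  with refl , a′ ← not-xor⇒≡ (not (odd k)) η a
  with bounds′ ← All.zipWith (λ (c<d , _ , d<N) → c<d , d<N)
                   (alternating-tail-greater refl cons a′ sorted , bounds)
  with N≤′ ← subst (N ≤_) (ℕ.+-suc k (length τ)) N≤
  -- If the first colour exceeded `k`, the tail would need more colours than remain below `N`.
  with refl ← ℕ.≤-antisym k≤c (ℕ.≤-pred (ℕ.+-cancelʳ-≤ (length τ) (suc c) (suc k)
                (ℕ.≤-trans (alternating-bound (suc c) (not (not (odd k))) τ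
                  (λ p q → cons (there p) (there q)) a′ sorted′ bounds′ c<N) N≤′)))
  with ℕ.m≤n⇒m<n∨m≡n k≤j
... | inj₂ refl = here refl
... | inj₁ k<j  = there (all-colours (suc k) τ (λ p q → cons (there p) (there q)) a′ sorted′
                    bounds′ N≤′ j k<j j<N)

negate-involutive : ∀ {X : Set} (σ : List (Bool × X)) → map negate (map negate σ) ≡ σ
negate-involutive []            = refl
negate-involutive ((ε , x) ∷ σ) =
  cong₂ (λ η τ → (η , x) ∷ τ) (Bool.not-involutive ε) (negate-involutive σ)

-- With `s = suc p` this provides a coordinate in relation `∼` to itself, which can therefore be
-- constant on the equator of a suspension.
half : ∀ p → ∃ λ ρ → 1 ≤ ρ × ρ ≤ suc p × (ρ + ρ ≡ suc p ⊎ ρ + ρ ≡ suc (suc p))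
half 0             = 1 , s≤s z≤n , s≤s z≤n , inj₂ refl
half 1             = 1 , s≤s z≤n , s≤s z≤n , inj₁ refl
half (suc (suc p)) with ρ , 1≤ρ , ρ≤1+p , e ← half p =
    suc ρ , s≤s z≤n , s≤s (ℕ.m≤n⇒m≤1+n ρ≤1+p)
  , Sum.map lift lift e
  where
  lift : ∀ {ρ n} → ρ + ρ ≡ n → suc ρ + suc ρ ≡ suc (suc n)
  lift {ρ} e = cong suc (trans (ℕ.+-suc ρ ρ) (cong suc e))

-- New coordinates and homotopy stages.

module Coordinates (p : ℕ) where

  s : ℕ
  s = suc p

  -- The entry x of a vertex of W(s,t) is replaced by a, where x = 2a if x is
  -- even and x = 2s + 1 − 2a if x is odd; this turns adjacency into ∼ and the
  -- values 0 and 1 into 0 and s.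
  data _∼_ (a b : ℕ) : Set where
    exact  : a + b ≡ s     → a ∼ b
    excess : a + b ≡ suc s → a ∼ b

  ∼-sym : ∀ {a b} → a ∼ b → b ∼ a
  ∼-sym {a} {b} (exact e)  = exact  (trans (ℕ.+-comm b a) e)
  ∼-sym {a} {b} (excess e) = excess (trans (ℕ.+-comm b a) e)

  ∼⇒s≤ : ∀ {a b} → a ∼ b → s ≤ a + b
  ∼⇒s≤ (exact e)  = ℕ.≤-reflexive (sym e)
  ∼⇒s≤ (excess e) = ℕ.≤-trans (ℕ.n≤1+n s) (ℕ.≤-reflexive (sym e))

  ∼⇒≤1+s : ∀ {a b} → a ∼ b → a + b ≤ suc s
  ∼⇒≤1+s (exact e)  = ℕ.≤-trans (ℕ.≤-reflexive e) (ℕ.n≤1+n s)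
  ∼⇒≤1+s (excess e) = ℕ.≤-reflexive e

  bounds⇒∼ : ∀ {a b} → s ≤ a + b → a + b ≤ suc s → a ∼ b
  bounds⇒∼ l u with ℕ.m≤n⇒m<n∨m≡n u
  ... | inj₁ (s≤s u′) = exact (ℕ.≤-antisym u′ l)
  ... | inj₂ e        = excess e

  -- If minimum and maximum select from the same pair, a hypothesis applies; otherwise the mixed sum
  -- lies between `e + d` and `a + b`.
  cap-∼ : ∀ {a b e d} → e ∼ d → a ∼ b → (e ⊓ a) ∼ (d ⊔ b)
  cap-∼ {a} {b} {e} {d} e∼d a∼b with ℕ.≤-total e a | ℕ.≤-total d b
  ... | inj₁ e≤a | inj₁ d≤b rewrite ℕ.m≤n⇒m⊓n≡m e≤a | ℕ.m≤n⇒m⊔n≡n d≤b =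
    bounds⇒∼ (ℕ.≤-trans (∼⇒s≤ e∼d) (ℕ.+-monoʳ-≤ e d≤b))
             (ℕ.≤-trans (ℕ.+-monoˡ-≤ b e≤a) (∼⇒≤1+s a∼b))
  ... | inj₁ e≤a | inj₂ b≤d rewrite ℕ.m≤n⇒m⊓n≡m e≤a | ℕ.m≥n⇒m⊔n≡m b≤d = e∼d
  ... | inj₂ a≤e | inj₁ d≤b rewrite ℕ.m≥n⇒m⊓n≡n a≤e | ℕ.m≤n⇒m⊔n≡n d≤b = a∼b
  ... | inj₂ a≤e | inj₂ b≤d rewrite ℕ.m≥n⇒m⊓n≡n a≤e | ℕ.m≥n⇒m⊔n≡m b≤d =
    bounds⇒∼ (ℕ.≤-trans (∼⇒s≤ a∼b) (ℕ.+-monoʳ-≤ a b≤d))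
             (ℕ.≤-trans (ℕ.+-monoˡ-≤ d a≤e) (∼⇒≤1+s e∼d))

  Valid : ∀ {t} → Vec ℕ t → Set
  Valid x = (∀ i → lookup x i ≤ s)
          × (∃ λ i → lookup x i ≡ 0 × (∀ j → lookup x j ≡ 0 → i ≡ j))
          × (∃ λ j → lookup x j ≡ s)

  Adj : ∀ {t} → Vec ℕ t → Vec ℕ t → Set
  Adj x y = ∀ i → lookup x i ∼ lookup y i

  -- A homotopy stage sends (+, x) to (r, min(e, x₁), …) and (−, x) to
  -- (q, max(d, x₁), …).
  record Stage : Set where
    constructor stage
    field
      e r d q   : ℕ
      1≤e       : 1 ≤ e
      1≤r       : 1 ≤ r
      r≤s       : r ≤ s
      e≡s⊎r≡s   : e ≡ s ⊎ r ≡ s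
      d≤s       : d ≤ s
      q≤s       : q ≤ s
      one-zero  : (d ≡ 0 × 1 ≤ q) ⊎ (1 ≤ d × q ≡ 0)

  -- This keeps positive vertices moved by `F` adjacent to negative vertices moved by `G`.
  Link : Stage → Stage → Set
  Link F G = Stage.e F ∼ Stage.d G × Stage.r F ∼ Stage.q G

  Signed : ℕ → Set
  Signed t = Bool × Vec ℕ t

  move : ∀ {t} → Stage → Signed t → Signed (suc t)
  move F (true  , x) = true  , Stage.r F ∷ Vec.map (Stage.e F ⊓_) x
  move F (false , x) = false , Stage.q F ∷ Vec.map (Stage.d F ⊔_) x

  -- On the positive side, `1≤e` and `1≤r` prevent new zeros and `e≡s⊎r≡s` saves an entry `s`. On
  -- the negative side a maximum preserves entries `s`, and `one-zero` either keeps the old zero or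
  -- hands its role to the new coordinate.
  move-valid : ∀ {t} F (v : Signed t) → Valid (proj₂ v) → Valid (proj₂ (move F v))
  move-valid F (true , x) (x≤s , (i , xi≡0 , unique) , (k , xk≡s)) =
    bound , (suc i , zero-at-i , unique′) , top e≡s⊎r≡s
    where
    open Stage F
    at : ∀ j → lookup (Vec.map (e ⊓_) x) j ≡ e ⊓ lookup x j
    at j = Vec.lookup-map j (e ⊓_) x
    bound : ∀ j → lookup (r ∷ Vec.map (e ⊓_) x) j ≤ s
    bound zero    = r≤s
    bound (suc j) rewrite at j = ℕ.≤-trans (ℕ.m⊓n≤n e _) (x≤s j)
    zero-at-i : lookup (Vec.map (e ⊓_) x) i ≡ 0
    zero-at-i = trans (at i) (trans (cong (e ⊓_) xi≡0) (ℕ.⊓-zeroʳ e))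
    unique′ : ∀ j → lookup (r ∷ Vec.map (e ⊓_) x) j ≡ 0 → suc i ≡ j
    unique′ zero    r≡0 = contradiction (subst (1 ≤_) r≡0 1≤r) λ ()
    unique′ (suc j) z with ℕ.⊓-sel e (lookup x j)
    ... | inj₁ ⊓≡e = contradiction (subst (1 ≤_) (trans (sym ⊓≡e) (trans (sym (at j)) z)) 1≤e) λ ()
    ... | inj₂ ⊓≡x = cong suc (unique j (trans (sym ⊓≡x) (trans (sym (at j)) z)))
    top : e ≡ s ⊎ r ≡ s → ∃ λ j → lookup (r ∷ Vec.map (e ⊓_) x) j ≡ s
    top (inj₁ e≡s) = suc k , trans (at k) (trans (cong₂ _⊓_ e≡s xk≡s) (ℕ.⊓-idem s))
    top (inj₂ r≡s) = zero , r≡s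
  move-valid F (false , x) (x≤s , (i , xi≡0 , unique) , (k , xk≡s)) =
    bound , zeros one-zero , suc k , trans (at k)
      (trans (cong (d ⊔_) xk≡s) (ℕ.m≤n⇒m⊔n≡n d≤s))
    where
    open Stage F
    at : ∀ j → lookup (Vec.map (d ⊔_) x) j ≡ d ⊔ lookup x j
    at j = Vec.lookup-map j (d ⊔_) x
    bound : ∀ j → lookup (q ∷ Vec.map (d ⊔_) x) j ≤ s
    bound zero    = q≤s
    bound (suc j) rewrite at j = ℕ.⊔-lub d≤s (x≤s j)
    zeros : (d ≡ 0 × 1 ≤ q) ⊎ (1 ≤ d × q ≡ 0) →
      ∃ λ i → lookup (q ∷ Vec.map (d ⊔_) x) i ≡ 0
            × (∀ j → lookup (q ∷ Vec.map (d ⊔_) x) j ≡ 0 → i ≡ j)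
    zeros (inj₁ (d≡0 , 1≤q)) = suc i , trans (at i) (cong₂ _⊔_ d≡0 xi≡0) , λ where
      zero    q≡0 → contradiction (subst (1 ≤_) q≡0 1≤q) λ ()
      (suc j) z   → cong suc (unique j (ℕ.n≤0⇒n≡0
        (ℕ.≤-trans (ℕ.m≤n⊔m d _) (ℕ.≤-reflexive (trans (sym (at j)) z)))))
    zeros (inj₂ (1≤d , q≡0)) = zero , q≡0 , λ where
      zero    _ → refl
      (suc j) z → contradiction
        (ℕ.≤-trans 1≤d (ℕ.≤-trans (ℕ.m≤m⊔n d _) (ℕ.≤-reflexive (trans (sym (at j)) z)))) λ ()

  move-adj : ∀ {t} F G {x y : Vec ℕ t} → Link F G → Adj x y →
             Adj (proj₂ (move F (true , x))) (proj₂ (move G (false , y)))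
  move-adj F G (e∼d , r∼q) x~y zero    = r∼q
  move-adj F G {x} {y} (e∼d , r∼q) x~y (suc i) = subst₂ _∼_
    (sym (Vec.lookup-map i _ x)) (sym (Vec.lookup-map i _ y)) (cap-∼ e∼d (x~y i))

  Cross : ∀ {t} → List (Signed t) → Set
  Cross L = (∀ {v} → v ∈ L → Valid (proj₂ v))
          × (∀ {x y} → (true , x) ∈ L → (false , y) ∈ L → Adj x y)

  -- The vertices lie in a biclique with two nonempty sides, so that either side
  -- of the simplex has a common neighbour even if the other one is empty.
  Good : ∀ {t} → List (Signed t) → Set
  Good σ = ∃ λ L → Cross L × (∃ λ x → (true , x) ∈ L) × (∃ λ y → (false , y) ∈ L)
                 × All (_∈ L) σ

  Simplex : ∀ {t} → ℕ → List (Signed t) → Set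
  Simplex n σ = length σ ≡ n × Good σ

  move-true : ∀ {t} F {v : Signed t} {x} → (true , x) ≡ move F v →
              ∃ λ x′ → v ≡ (true , x′)
  move-true F {true , x} _ = x , refl

  move-false : ∀ {t} F {v : Signed t} {x} → (false , x) ≡ move F v →
               ∃ λ x′ → v ≡ (false , x′)
  move-false F {false , x} _ = x , refl

  -- A prism mixes vertices from both of its stages, hence the links in all four combinations.
  cross-moves : ∀ {t} F G {L : List (Signed t)} → Link F F → Link F G → Link G F → Link G G →
                Cross L → Cross (map (move F) L ++ map (move G) L)
  cross-moves F G {L} ff fg gf gg (valid , adj) = valid′ , adj′
    where
    valid′ : ∀ {v} → v ∈ map (move F) L ++ map (move G) L → Valid (proj₂ v)
    valid′ v∈ with ∈-++⁻ (map (move F) L) v∈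
    ... | inj₁ v∈F with v , v∈L , refl ← ∈-map⁻ (move F) v∈F = move-valid F v (valid v∈L)
    ... | inj₂ v∈G with v , v∈L , refl ← ∈-map⁻ (move G) v∈G = move-valid G v (valid v∈L)

    adj″ : ∀ F G {x y} → Link F G → (true , x) ∈ map (move F) L → (false , y) ∈ map (move G) L →
           Adj x y
    adj″ F G l x∈ y∈
      with v , v∈L , ev ← ∈-map⁻ (move F) x∈ | w , w∈L , ew ← ∈-map⁻ (move G) y∈
      with _ , refl ← move-true F ev | _ , refl ← move-false G ew
      with refl ← ev | refl ← ew = move-adj F G l (adj v∈L w∈L)

    adj′ : ∀ {x y} → (true , x) ∈ map (move F) L ++ map (move G) L →
           (false , y) ∈ map (move F) L ++ map (move G) L → Adj x y
    adj′ x∈ y∈ with ∈-++⁻ (map (move F) L) x∈ | ∈-++⁻ (map (move F) L) y∈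
    ... | inj₁ x∈F | inj₁ y∈F = adj″ F F ff x∈F y∈F
    ... | inj₁ x∈F | inj₂ y∈G = adj″ F G fg x∈F y∈G
    ... | inj₂ x∈G | inj₁ y∈F = adj″ G F gf x∈G y∈F
    ... | inj₂ x∈G | inj₂ y∈G = adj″ G G gg x∈G y∈G

  -- Filling the cycle in one hemisphere.

  module Fill {t n} (S : Chain (Signed t)) (cycle : IsCycle S) (simplices : All (Simplex n) S) where

    Filling : Stage → Set
    Filling F = Σ[ P ∈ Chain (Signed (suc t)) ]
      (∀ u → eval (δ u) P ≡ eval u (map (map (move F)) S)) × All (Simplex (suc n)) P

    -- The prisms from `F` to `G` are bounded by the two moved copies of `S`, and the copy under `G`
    -- cancels against the boundary of the given filling.
    fill-step : ∀ F G → Link F F → Link F G → Link G F → Link G G → Filling G → Filling F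
    fill-step F G ff fg gf gg (P , ∂P , P-simplices) =
        Q ++ P , ∂Q++P , All.++⁺ (All.concat⁺ (All.map⁺ (move-prism simplices))) P-simplices
      where
      Q = concatMap (prism (move F) (move G)) S

      ∂Q++P : ∀ u → eval (δ u) (Q ++ P) ≡ eval u (map (map (move F)) S)
      ∂Q++P u = begin
        eval (δ u) (Q ++ P)                ≡⟨ eval-++ (δ u) Q P ⟩
        eval (δ u) Q xor eval (δ u) P
          ≡⟨ cong₂ _xor_ (∂-prisms S cycle (move F) (move G) u) (∂P u) ⟩
        (f xor g) xor g                    ≡⟨ solve 2 (λ a b → (a :+ b) :+ b := a) refl f g ⟩
        f                                  ∎
        where
        open ≡-Reasoning
        f = eval u (map (map (move F)) S)
        g = eval u (map (map (move G)) S)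

      move-prism : ∀ {C} → All (Simplex n) C →
                   All (λ σ → All (Simplex (suc n)) (prism (move F) (move G) σ)) C
      move-prism = All.map λ (len , L , cross , (x , x∈) , (y , y∈) , σ⊆L) →
        All.map (λ (len′ , τ⊆) → trans len′ (cong suc len) ,
            map (move F) L ++ map (move G) L
          , cross-moves F G ff fg gf gg cross
          , (_ , ∈-++⁺ˡ (∈-map⁺ (move F) x∈))
          , (_ , ∈-++⁺ˡ (∈-map⁺ (move F) y∈))
          , τ⊆)
        (prism-All (λ v∈L → ∈-++⁺ˡ (∈-map⁺ (move F) v∈L)
                          , ∈-++⁺ʳ (map (move F) L) (∈-map⁺ (move G) v∈L)) σ⊆L)

    -- Second phase of the homotopy: the new coordinate rests at `s` and 0 on the two sides, while
    -- the cap and the floor on the old ones vary.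
    shrink-stage : ∀ e d → 1 ≤ d → d ≤ s → Stage
    shrink-stage e d 1≤d d≤s = stage (suc e) s d 0 (s≤s z≤n) (s≤s z≤n) ℕ.≤-refl (inj₂ refl)
                                     d≤s z≤n (inj₂ (1≤d , refl))

    end : Stage
    end = shrink-stage 0 s (s≤s z≤n) ℕ.≤-refl

    apex : Vec ℕ (suc t)
    apex = 0 ∷ Vec.replicate t s

    s∼0 : s ∼ 0
    s∼0 = exact (ℕ.+-identityʳ s)

    s∼1 : s ∼ 1
    s∼1 = excess (ℕ.+-comm s 1)

    apex-valid : ∀ {x : Vec ℕ t} → Valid x → Valid apex
    apex-valid (_ , (i , _) , _) = bound , (zero , refl , unique)
                                 , suc i , Vec.lookup-replicate i s
      where
      bound : ∀ j → lookup apex j ≤ s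
      bound zero    = z≤n
      bound (suc j) = ℕ.≤-reflexive (Vec.lookup-replicate j s)
      unique : ∀ j → lookup apex j ≡ 0 → zero ≡ j
      unique zero    _ = refl
      unique (suc j) z with () ← trans (sym (Vec.lookup-replicate j s)) z

    apex-adj : ∀ {x} → Adj (proj₂ (move end (true , x))) apex
    apex-adj     zero    = s∼0
    apex-adj {x} (suc i) = subst₂ _∼_
      (sym (Vec.lookup-map i (1 ⊓_) x)) (sym (Vec.lookup-replicate i s))
      (bounds⇒∼ (ℕ.m≤n+m s _) (ℕ.+-monoˡ-≤ s (ℕ.m⊓n≤m 1 (lookup x i))))

    -- At floor `s` every negative vertex has become the apex, and at cap 1 every positive vertex is
    -- adjacent to it, so coning stays within a biclique. A repeated apex is harmless, as simplices
    -- are arbitrary lists.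
    fill-end : Filling end
    fill-end = map cone S , ∂-cone S cycle (move end) (false , apex)
             , All.map⁺ (All.map cone-simplex simplices)
      where
      cone : List (Signed t) → List (Signed (suc t))
      cone σ = (false , apex) ∷ map (move end) σ

      end-link : Link end end
      end-link = excess refl , s∼0

      cone-simplex : ∀ {σ} → Simplex n σ → Simplex (suc n) (cone σ)
      cone-simplex {σ} (len , L , cross@(valid , _) , (x , x∈) , _ , σ⊆L) =
          cong suc (trans (List.length-map (move end) σ) len)
        , cone L , (cone-valid , cone-adj)
        , (_ , there (∈-map⁺ (move end) x∈)) , (_ , here refl)
        , here refl ∷ All.map⁺ (All.map (there ∘ ∈-map⁺ (move end)) σ⊆L)
        where
        cone-valid : ∀ {v} → v ∈ cone L → Valid (proj₂ v)
        cone-valid (here refl) = apex-valid {x} (valid x∈)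
        cone-valid (there v∈) with v , v∈L , refl ← ∈-map⁻ (move end) v∈ =
          move-valid end v (valid v∈L)
        cone-adj : ∀ {x y} → (true , x) ∈ cone L → (false , y) ∈ cone L → Adj x y
        cone-adj (there x∈) (here refl) with v , _ , ev ← ∈-map⁻ (move end) x∈
          with x , refl ← move-true end ev with refl ← ev = apex-adj {x}
        cone-adj (there x∈) (there y∈) =
          proj₂ (cross-moves end end end-link end-link end-link end-link cross)
            (∈-++⁺ˡ x∈) (∈-++⁺ˡ y∈)

    fill-shrink : ∀ e d 1≤d d≤s → suc e + d ≡ suc s → Filling (shrink-stage e d 1≤d d≤s)
    fill-shrink zero    d 1≤d d≤s eq with refl ← ℕ.suc-injective eq =
      subst₂ (λ a b → Filling (shrink-stage zero d a b))
        (ℕ.≤-irrelevant _ 1≤d) (ℕ.≤-irrelevant _ d≤s) fill-end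
    fill-shrink (suc e) d 1≤d d≤s eq =
      -- The cap drops by one, then the floor rises by one, so their sum goes from `s + 1` to `s`
      -- and back, the two values that `∼` allows.
      fill-step F G (excess eq , s∼0) (excess eq , s∼0) (exact eq₁ , s∼0) (exact eq₁ , s∼0)
        (fill-step G H (exact eq₁ , s∼0) (excess eq₂ , s∼0) (exact eq₁ , s∼0) (excess eq₂ , s∼0)
          (fill-shrink e (suc d) (s≤s z≤n) 1+d≤s eq₂))
      where
      eq₁ : suc e + d ≡ s
      eq₁ = ℕ.suc-injective eq
      eq₂ : suc e + suc d ≡ suc s
      eq₂ = trans (ℕ.+-suc (suc e) d) (cong suc eq₁)
      1+d≤s : suc d ≤ s
      1+d≤s = ℕ.≤-trans (s≤s (ℕ.m≤n+m d e)) (ℕ.≤-reflexive eq₁)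
      F = shrink-stage (suc e) d 1≤d d≤s
      G = shrink-stage e d 1≤d d≤s
      H = shrink-stage e (suc d) (s≤s z≤n) 1+d≤s

    -- First phase: cap `s` and floor 0 leave the old coordinates alone, and only the new one moves.
    lift-stage : ∀ r q → 1 ≤ r → r ≤ s → suc q ≤ s → Stage
    lift-stage r q 1≤r r≤s q<s = stage s r 0 (suc q) (s≤s z≤n) 1≤r r≤s (inj₁ refl) z≤n q<s
                                       (inj₁ (refl , s≤s z≤n))

    fill-lift : ∀ r q 1≤r r≤s q<s → r + suc q ≡ suc s → Filling (lift-stage r q 1≤r r≤s q<s)
    fill-lift r zero 1≤r r≤s q<s eq
      with refl ← ℕ.suc-injective (trans (ℕ.+-comm 1 r) eq) =
      -- Passage between the phases: on the negative side the new coordinate falls from 1 to 0 while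
      -- the floor rises from 0 to 1, which moves the unique zero. Both `s ∼ 0` and `s ∼ 1` hold, so
      -- all links survive.
      fill-step (lift-stage s zero 1≤r r≤s q<s) (shrink-stage p 1 (s≤s z≤n) (s≤s z≤n))
        (s∼0 , s∼1) (s∼1 , s∼0) (s∼0 , s∼1) (s∼1 , s∼0)
        (fill-shrink p 1 (s≤s z≤n) (s≤s z≤n) (ℕ.+-comm s 1))
    fill-lift r (suc q) 1≤r r≤s q<s eq =
      -- The negative coordinate falls first, then the positive one rises, with sums `s + 1`, `s`,
      -- `s + 1`.
      fill-step F G (s∼0 , excess eq) (s∼0 , exact eq₁) (s∼0 , excess eq) (s∼0 , exact eq₁)
        (fill-step G H (s∼0 , exact eq₁) (s∼0 , exact eq₁) (s∼0 , excess eq₂) (s∼0 , excess eq₂)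
          (fill-lift (suc r) q (s≤s z≤n) 1+r≤s (ℕ.<⇒≤ q<s) eq₂))
      where
      eq₁ : r + suc q ≡ s
      eq₁ = ℕ.suc-injective (trans (sym (ℕ.+-suc r (suc q))) eq)
      eq₂ : suc r + suc q ≡ suc s
      eq₂ = cong suc eq₁
      1+r≤s : suc r ≤ s
      1+r≤s = ℕ.≤-trans (ℕ.≤-reflexive (ℕ.+-comm 1 r))
                (ℕ.≤-trans (ℕ.+-monoʳ-≤ r (s≤s z≤n)) (ℕ.≤-reflexive eq₁))
      F = lift-stage r (suc q) 1≤r r≤s q<s
      G = lift-stage r q 1≤r r≤s (ℕ.<⇒≤ q<s)
      H = lift-stage (suc r) q (s≤s z≤n) 1+r≤s (ℕ.<⇒≤ q<s)

    fill-middle : ∀ ρ → 1 ≤ ρ → ρ ≤ s → ρ + ρ ≡ s ⊎ ρ + ρ ≡ suc s →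
      Σ[ F ∈ Stage ] Stage.e F ≡ s × Stage.d F ≡ 0 × Stage.r F ≡ ρ × Stage.q F ≡ ρ × Filling F
    fill-middle (suc q) 1≤ρ ρ≤s (inj₂ eq) =
      lift-stage (suc q) q 1≤ρ ρ≤s ρ≤s , refl , refl , refl , refl
      , fill-lift (suc q) q 1≤ρ ρ≤s ρ≤s eq
    fill-middle (suc q) 1≤ρ ρ≤s (inj₁ eq) =
      F , refl , refl , refl , refl
      -- Here the two coordinates start with sum `s`; one preliminary step raises the positive one
      -- to reach the sum `s + 1`.
      , fill-step F G (s∼0 , exact eq) (s∼0 , exact eq) (s∼0 , excess (cong suc eq))
          (s∼0 , excess (cong suc eq)) (fill-lift (2 + q) q (s≤s z≤n) 1+ρ≤s ρ≤s (cong suc eq))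
      where
      1+ρ≤s : 2 + q ≤ s
      1+ρ≤s = ℕ.≤-trans (s≤s (ℕ.m≤n+m (suc q) q)) (ℕ.≤-reflexive eq)
      F = lift-stage (suc q) q 1≤ρ ρ≤s ρ≤s
      G = lift-stage (2 + q) q (s≤s z≤n) 1+ρ≤s ρ≤s

  -- Symmetric cycles by suspension.

  record Sphere (t n : ℕ) : Set where
    field
      S         : Chain (Signed t)
      cycle     : IsCycle S
      symmetric : ∀ u → eval u S ≡ eval (u ∘ map negate) S
      simplices : All (Simplex n) S
      -- Asked of every `c`, proper or not, so that the induction can pass to the restriction of a
      -- colouring to the equator.
      fan-odd   : ∀ c → eval (fan c true) S ≡ true

  -- The 0-sphere: two points of opposite sign over the same `x`. Its neighbour `y` supplies the
  -- other side of the bicliques.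
  sphere₂ : Sphere 2 1
  sphere₂ = record
    { S         = ((true , x) ∷ []) ∷ ((false , x) ∷ []) ∷ []
    ; cycle     = λ u → solve 1 (λ a → (a :+ con false) :+ ((a :+ con false) :+ con false)
                          := con false) refl (u [])
    ; symmetric = λ u → solve 2 (λ a b → a :+ (b :+ con false) := b :+ (a :+ con false)) refl
                          (u ((true , x) ∷ [])) (u ((false , x) ∷ []))
    ; simplices =
        (refl , (true , x) ∷ (false , y) ∷ []
              , ((λ { (here refl) → x-valid ; (there (here refl)) → y-valid })
                , λ { (here refl) (there (here refl)) → x~y ; (there (here ())) _ })
              , (_ , here refl) , (_ , there (here refl)) , here refl ∷ [])
      ∷ (refl , (false , x) ∷ (true , y) ∷ []
              , ((λ { (here refl) → x-valid ; (there (here refl)) → y-valid })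
                , λ { (there (here refl)) (here refl) → ∼-sym ∘ x~y ; _ (there (here ())) })
              , (_ , there (here refl)) , (_ , here refl) , here refl ∷ [])
      ∷ []
    ; fan-odd   = λ c → fan-odd (odd (c x))
    }
    where
    x = 0 ∷ s ∷ []
    y = s ∷ 0 ∷ []
    x-valid : Valid x
    x-valid = (λ { zero → z≤n ; (suc zero) → ℕ.≤-refl })
            , (zero , refl , λ { zero _ → refl ; (suc zero) () })
            , suc zero , refl
    y-valid : Valid y
    y-valid = (λ { zero → ℕ.≤-refl ; (suc zero) → z≤n })
            , (suc zero , refl , λ { zero () ; (suc zero) _ → refl })
            , zero , refl
    x~y : Adj x y
    x~y zero       = exact refl
    x~y (suc zero) = exact (ℕ.+-identityʳ s)
    -- Whatever the parity of the colour, exactly one of the two signs yields the label sign `true`.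
    fan-odd : ∀ b → (not (true xor (b xor true)) ∧ true) xor
                    ((not (true xor (b xor false)) ∧ true) xor false) ≡ true
    fan-odd true  = refl
    fan-odd false = refl

  simplex-negate : ∀ {t n} {σ : List (Signed t)} → Simplex n σ → Simplex n (map negate σ)
  simplex-negate {σ = σ} (len , L , (valid , adj) , (_ , x∈) , (_ , y∈) , σ⊆L) =
      trans (List.length-map negate σ) len
    , map negate L , (valid′ , adj′) , (_ , ∈-map⁺ negate y∈) , (_ , ∈-map⁺ negate x∈)
    , All.map⁺ (All.map (∈-map⁺ negate) σ⊆L)
    where
    valid′ : ∀ {v} → v ∈ map negate L → Valid (proj₂ v)
    valid′ v∈ with _ , v∈L , refl ← ∈-map⁻ negate v∈ = valid v∈L
    adj′ : ∀ {x y} → (true , x) ∈ map negate L → (false , y) ∈ map negate L → Adj x y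
    adj′ x∈ y∈ with (false , _) , x∈L , refl ← ∈-map⁻ negate x∈
                  | (true  , _) , y∈L , refl ← ∈-map⁻ negate y∈ = ∼-sym ∘ adj y∈L x∈L

  map-cap : ∀ {t} (x : Vec ℕ t) → (∀ i → lookup x i ≤ s) → Vec.map (s ⊓_) x ≡ x
  map-cap []      _   = refl
  map-cap (a ∷ x) x≤s =
    cong₂ _∷_ (ℕ.m≥n⇒m⊓n≡n (x≤s zero)) (map-cap x (x≤s ∘ suc))

  module Suspend {t n} (𝕊 : Sphere t n) where
    open Sphere 𝕊
    open Fill S cycle simplices

    ρ : ℕ
    ρ = proj₁ (half p)

    lift : Signed t → Signed (suc t)
    lift (ε , x) = ε , ρ ∷ x

    -- With cap `s`, floor 0 and both new coordinates equal to `ρ`, a move merely prepends `ρ` to a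
    -- valid vector, so the boundary is an equatorial copy of `S`.
    hemisphere : Σ[ P ∈ Chain (Signed (suc t)) ]
      (∀ u → eval (δ u) P ≡ eval (u ∘ map lift) S) × All (Simplex (suc n)) P
    hemisphere with 1≤ρ , ρ≤s , eq ← proj₂ (half p)
      with F , e≡s , d≡0 , r≡ρ , q≡ρ , P , ∂P , P-simplices ← fill-middle ρ 1≤ρ ρ≤s eq =
      P , (λ u → trans (∂P u) (trans (cong (eval u) (List.map-cong-local
            (All.map (λ (_ , L , (valid , _) , _ , _ , σ⊆L) →
               List.map-cong-local (All.map (λ {v} → move≡lift v ∘ valid) σ⊆L)) simplices)))
            (eval-map u (map lift) S)))
      , P-simplices
      where
      move≡lift : ∀ v → Valid (proj₂ v) → move F v ≡ lift v
      move≡lift (true , x) (x≤s , _) =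
        cong (true ,_) (cong₂ _∷_ r≡ρ (trans (cong (λ e → Vec.map (e ⊓_) x) e≡s) (map-cap x x≤s)))
      move≡lift (false , x) _ =
        cong (false ,_) (cong₂ _∷_ q≡ρ (trans (cong (λ d → Vec.map (d ⊔_) x) d≡0) (Vec.map-id x)))

    suspension : Sphere (suc t) (suc n)
    suspension with P , ∂P , P-simplices ← hemisphere = record
      { S         = P ++ map (map negate) P
      ; cycle     = cycle′
      ; symmetric = λ u → begin
          eval u (P ++ map (map negate) P)           ≡⟨ split u ⟩
          eval u P xor eval (u ∘ map negate) P       ≡⟨ Bool.xor-comm (eval u P) _ ⟩
          eval (u ∘ map negate) P xor eval u P
            ≡⟨ cong (eval (u ∘ map negate) P xor_)
                 (eval-cong (λ σ → cong u (negate-involutive σ)) P) ⟨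
          eval (u ∘ map negate) P xor eval (u ∘ map negate ∘ map negate) P
            ≡⟨ split (u ∘ map negate) ⟨
          eval (u ∘ map negate) (P ++ map (map negate) P) ∎
      ; simplices = All.++⁺ P-simplices (All.map⁺ (All.map simplex-negate P-simplices))
      ; fan-odd   = λ c → begin
          eval (fan c true) (P ++ map (map negate) P) ≡⟨ split (fan c true) ⟩
          eval (fan c true) P xor eval (fan c true ∘ map negate) P
            ≡⟨ eval-xor (fan c true) (fan c true ∘ map negate) P ⟨
          eval (λ σ → fan c true σ xor fan c true (map negate σ)) P
            ≡⟨ eval-cong (δ-fan c true) P ⟨
          eval (δ (fan c true)) P                    ≡⟨ ∂P (fan c true) ⟩
          eval (fan c true ∘ map lift) S
            ≡⟨ eval-cong (λ σ → cong (alt true ∘ sort) (List.map-∘ σ)) S ⟨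
          eval (fan (c ∘ (ρ ∷_)) true) S             ≡⟨ fan-odd (c ∘ (ρ ∷_)) ⟩
          true                                       ∎
      }
      where
      open ≡-Reasoning
      split : ∀ u → eval u (P ++ map (map negate) P) ≡ eval u P xor eval (u ∘ map negate) P
      split u = trans (eval-++ u P _) (cong (eval u P xor_) (eval-map u (map negate) P))

      -- The two hemispheres have the same boundary, since `lift` commutes with `negate` and `S` is
      -- symmetric.
      cycle′ : IsCycle (P ++ map (map negate) P)
      cycle′ u = begin
        eval (δ u) (P ++ map (map negate) P)             ≡⟨ split (δ u) ⟩
        eval (δ u) P xor eval (δ u ∘ map negate) P
          ≡⟨ cong₂ _xor_ (∂P u) (trans (eval-cong (δ-map u negate) P) (∂P (u ∘ map negate))) ⟩
        eval (u ∘ map lift) S xor eval (u ∘ map negate ∘ map lift) S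
          ≡⟨ cong₂ _xor_ (symmetric (u ∘ map lift))
               (eval-cong (λ σ → cong u (trans (sym (List.map-∘ σ)) (List.map-∘ σ))) S) ⟩
        eval (u ∘ map lift ∘ map negate) S xor eval (u ∘ map lift ∘ map negate) S
          ≡⟨ Bool.xor-same (eval (u ∘ map lift ∘ map negate) S) ⟩
        false ∎

  sphere : ∀ t → Sphere (2 + t) (1 + t)
  sphere zero    = sphere₂
  sphere (suc t) = Suspend.suspension (sphere t)

  -- Lower bound for proper colourings in the new coordinates.

  module _ {t} (c : Vec ℕ t → ℕ)
    (proper : ∀ {x y} → Valid x → Valid y → Adj x y → c x ≢ c y) where

    -- Vertices on opposite sides are adjacent and never share a colour; on one side the colour
    -- determines the sign.
    labels-consistent : ∀ {L : List (Signed t)} {τ} → Cross L →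
      All (λ ℓ → ∃ λ v → v ∈ L × ℓ ≡ label c v) τ → Consistent τ
    labels-consistent (valid , adj) from p q with All.lookup from p | All.lookup from q
    ... | (true  , x) , _ , refl | (true  , y) , _ , e =
      trans (cong (λ d → odd d xor true) (cong proj₁ e)) (sym (cong proj₂ e))
    ... | (false , x) , _ , refl | (false , y) , _ , e =
      trans (cong (λ d → odd d xor false) (cong proj₁ e)) (sym (cong proj₂ e))
    ... | (true  , x) , x∈ , refl | (false , y) , y∈ , e =
      contradiction (cong proj₁ e) (proper (valid x∈) (valid y∈) (adj x∈ y∈))
    ... | (false , x) , x∈ , refl | (true  , y) , y∈ , e =
      contradiction (sym (cong proj₁ e)) (proper (valid y∈) (valid x∈) (adj y∈ x∈))

    -- With only n colours, an alternating simplex with n vertices contains all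
    -- of them on one side, and a common neighbour of that side has none left.
    too-few-colours : ∀ {n m} → Sphere t n → (∀ {x} → Valid x → c x < m) → ¬ (m ≤ n)
    too-few-colours {n} {m} 𝕊 c<m m≤n
      with σ , σ∈S , alternating ← eval-true (fan c true) (Sphere.S 𝕊) (Sphere.fan-odd 𝕊 c)
      with len , L , cross@(valid , adj) , _ , (y , y∈) , σ⊆L ← All.lookup (Sphere.simplices 𝕊) σ∈S
      = bad (All.lookup from (all-colours 0 τ (labels-consistent cross from) alternating
          (sort-sorted (map (label c) σ)) bounds m≤len (c y) z≤n (c<m (valid y∈))))
      where
      τ = sort (map (label c) σ)

      from : All (λ ℓ → ∃ λ v → v ∈ L × ℓ ≡ label c v) τ
      from = All-sort (All.map⁺ (All.map (λ v∈L → _ , v∈L , refl) σ⊆L))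

      bounds : All (λ ℓ → 0 ≤ proj₁ ℓ × proj₁ ℓ < m) τ
      bounds = All.map (λ { (_ , v∈L , refl) → z≤n , c<m (valid v∈L) }) from

      m≤len : m ≤ length τ
      m≤len = ℕ.≤-trans m≤n (ℕ.≤-reflexive (sym (trans (length-sort (map (label c) σ))
        (trans (List.length-map (label c) σ) len))))

      -- A positive vertex with this label is a neighbour of `y` of the same colour; a negative
      -- vertex of that colour would carry the opposite sign.
      bad : ¬ (∃ λ v → v ∈ L × (c y , not (odd (c y))) ≡ label c v)
      bad ((true , x) , x∈ , e) =
        proper (valid x∈) (valid y∈) (adj x∈ y∈) (sym (cong proj₁ e))
      bad ((false , x) , x∈ , e) = Bool.not-¬ refl (sym (trans (cong proj₂ e)
        (trans (Bool.xor-identityʳ _) (cong odd (sym (cong proj₁ e))))))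

  -- Translation back to W(s,t).

  fold-high : ∀ {a} → s < a + a → suc (s + s) ∸ (a + a) < suc s
  fold-high {a} s<2a = s≤s (ℕ.≤-trans (ℕ.∸-monoʳ-≤ (suc (s + s)) s<2a)
    (ℕ.≤-reflexive (ℕ.m+n∸n≡m s s)))

  -- Inverse of the change of coordinates: the low half gives the even entries, the high half the
  -- odd ones in decreasing order.
  fold : ℕ → Fin (suc s)
  fold a with a + a ≤? s
  ... | yes 2a≤s = fromℕ< (s≤s 2a≤s)
  ... | no  2a≰s = fromℕ< (fold-high {a} (ℕ.≰⇒> 2a≰s))

  data FoldView (a : ℕ) : Set where
    low  : a + a ≤ s → toℕ (fold a) ≡ a + a → FoldView a
    high : s < a + a → toℕ (fold a) ≡ suc (s + s) ∸ (a + a) → FoldView a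

  foldView : ∀ a → FoldView a
  foldView a with a + a ≤? s in eq
  ... | yes 2a≤s = low 2a≤s (trans (cong toℕ fold≡) (Fin.toℕ-fromℕ< _))
    where
    fold≡ : fold a ≡ fromℕ< (s≤s 2a≤s)
    fold≡ rewrite eq = refl
  ... | no 2a≰s = high (ℕ.≰⇒> 2a≰s) (trans (cong toℕ fold≡) (Fin.toℕ-fromℕ< _))
    where
    fold≡ : fold a ≡ fromℕ< (fold-high {a} (ℕ.≰⇒> 2a≰s))
    fold≡ rewrite eq = refl

  double-∼ : ∀ {a b} → a ∼ b →
    (a + a) + (b + b) ≡ s + s ⊎ (a + a) + (b + b) ≡ suc (suc (s + s))
  double-∼ {a} {b} (exact e)  = inj₁ (trans (interchange a a b b) (cong₂ _+_ e e))
  double-∼ {a} {b} (excess e) = inj₂ (trans (interchange a a b b)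
    (trans (cong₂ _+_ e e) (cong suc (ℕ.+-suc s s))))

  -- `A` and `B` stand for doubled coordinates. The reflected value of `B` is `A + 1` if the sum is
  -- `2s`, and `A - 1` if it is `2s + 2`.
  fold-low-high : ∀ {A B} → A + B ≡ s + s ⊎ A + B ≡ suc (suc (s + s)) → B ≤ s + s →
                  ∣ A - (suc (s + s) ∸ B) ∣ ≡ 1
  fold-low-high {A} {B} (inj₁ e) _ = trans
    (cong ∣ A -_∣ (trans (cong (λ x → suc x ∸ B) (sym e)) (ℕ.m+n∸n≡m (suc A) B)))
    (∣n-1+n∣ A)
    where
    ∣n-1+n∣ : ∀ n → ∣ n - suc n ∣ ≡ 1
    ∣n-1+n∣ zero    = refl
    ∣n-1+n∣ (suc n) = ∣n-1+n∣ n
  fold-low-high {zero} {B} (inj₂ e) B≤ =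
    contradiction (ℕ.≤-trans (ℕ.≤-reflexive (sym e)) B≤) (ℕ.<⇒≱ (ℕ.n<1+n _) ∘ ℕ.<⇒≤)
  fold-low-high {suc A} {B} (inj₂ e) _ = trans
    (cong ∣ suc A -_∣ (trans (cong (_∸ B) (sym (ℕ.suc-injective e))) (ℕ.m+n∸n≡m A B)))
    (∣1+n-n∣ A)
    where
    ∣1+n-n∣ : ∀ n → ∣ suc n - n ∣ ≡ 1
    ∣1+n-n∣ zero    = refl
    ∣1+n-n∣ (suc n) = ∣1+n-n∣ n

  -- A low and a high value land at distance one. Two low doubles are at most `s` and two high ones
  -- at least `s + 1`, so the sum leaves only the extreme case, in which both entries are `s`.
  fold-close : ∀ {a b} → a ≤ s → b ≤ s → a ∼ b → Close s (toℕ (fold a)) (toℕ (fold b))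
  fold-close {a} {b} a≤s b≤s a∼b with foldView a | foldView b
  ... | low la ea | high hb eb rewrite ea | eb =
    inj₁ (fold-low-high {a + a} (double-∼ a∼b) (ℕ.+-mono-≤ b≤s b≤s))
  ... | high ha ea | low lb eb rewrite ea | eb =
    inj₁ (trans (ℕ.∣-∣-comm _ (b + b))
      (fold-low-high {b + b} (double-∼ (∼-sym a∼b)) (ℕ.+-mono-≤ a≤s a≤s)))
  ... | low la ea | low lb eb with double-∼ a∼b
  ...   | inj₁ e = inj₂ (trans ea (squeeze la lb e) , trans eb (squeeze lb la (trans (ℕ.+-comm (b + b) _) e)))
    where
    squeeze : ∀ {A B} → A ≤ s → B ≤ s → A + B ≡ s + s → A ≡ s
    squeeze {A} A≤s B≤s e = ℕ.≤-antisym A≤s (ℕ.+-cancelʳ-≤ s s A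
      (ℕ.≤-trans (ℕ.≤-reflexive (sym e)) (ℕ.+-monoʳ-≤ A B≤s)))
  ...   | inj₂ e = contradiction (ℕ.≤-trans (ℕ.≤-reflexive (sym e)) (ℕ.+-mono-≤ la lb))
                     (ℕ.<⇒≱ (ℕ.n<1+n _) ∘ ℕ.<⇒≤)
  fold-close {a} {b} a≤s b≤s a∼b | high ha ea | high hb eb with double-∼ a∼b
  ...   | inj₁ e = contradiction (ℕ.≤-trans (ℕ.+-mono-≤ ha hb) (ℕ.≤-reflexive e))
                     (ℕ.<⇒≱ (s≤s (ℕ.+-monoʳ-≤ s (ℕ.n≤1+n s))))
  ...   | inj₂ e = inj₂ (trans ea (squeeze ha hb e) , trans eb (squeeze hb ha (trans (ℕ.+-comm (b + b) _) e)))
    where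
    squeeze : ∀ {A B} → s < A → s < B → A + B ≡ suc (suc (s + s)) → suc (s + s) ∸ A ≡ s
    squeeze {A} {B} s<A s<B e = trans (cong (suc (s + s) ∸_) A≡1+s) (ℕ.m+n∸n≡m s s)
      where
      A≡1+s : A ≡ suc s
      A≡1+s = ℕ.≤-antisym (ℕ.+-cancelʳ-≤ (suc s) A (suc s) (ℕ.≤-trans (ℕ.+-monoʳ-≤ A s<B)
        (ℕ.≤-reflexive (trans e (cong suc (sym (ℕ.+-suc s s))))))) s<A

  fold-0 : toℕ (fold 0) ≡ 0
  fold-0 with foldView 0
  ... | low _ e = e

  fold-s : toℕ (fold s) ≡ 1
  fold-s with foldView s
  ... | low 2s≤s _ = contradiction 2s≤s (ℕ.<⇒≱ (ℕ.m<m+n s (s≤s z≤n)))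
  ... | high _ e   = trans e (ℕ.m+n∸n≡m 1 (s + s))

  fold≡0 : ∀ {a} → a ≤ s → toℕ (fold a) ≡ 0 → a ≡ 0
  fold≡0 {a} a≤s z with foldView a
  ... | low _ e  = ℕ.m+n≡0⇒m≡0 a (trans (sym e) z)
  ... | high _ e = contradiction (ℕ.+-mono-≤ a≤s a≤s)
                     (ℕ.<⇒≱ (ℕ.m∸n≡0⇒m≤n (trans (sym e) z)))

  sequence : ∀ {t} → Vec ℕ t → Sequence s t
  sequence = Vec.map fold

  entry-sequence : ∀ {t} (x : Vec ℕ t) i → entry s t (sequence x) i ≡ toℕ (fold (lookup x i))
  entry-sequence x i = cong toℕ (Vec.lookup-map i fold x)

  valid⇒vertex : ∀ {t} (x : Vec ℕ t) → Valid x → IsVertex s t (sequence x)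
  valid⇒vertex x (x≤s , (i , xi≡0 , unique) , (k , xk≡s)) =
      (i , trans (entry-sequence x i) (trans (cong (toℕ ∘ fold) xi≡0) fold-0)
         , λ {j} z → unique j (fold≡0 (x≤s j) (trans (sym (entry-sequence x j)) z)))
    , k , trans (entry-sequence x k) (trans (cong (toℕ ∘ fold) xk≡s) fold-s)

  adj⇒adjacent : ∀ {t} (x y : Vec ℕ t) → Valid x → Valid y → Adj x y →
                 Adjacent s t (sequence x) (sequence y)
  adj⇒adjacent x y (x≤s , _) (y≤s , _) x~y i = subst₂ (Close s)
    (sym (entry-sequence x i)) (sym (entry-sequence y i)) (fold-close (x≤s i) (y≤s i) (x~y i))

  W-edge : ∀ t → HasEdge (W s (2 + t))
  -- The constant colouring serves to exhibit a simplex of the sphere; both sides of its biclique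
  -- are nonempty and give the edge.
  W-edge t with σ , σ∈S , _ ← eval-true (fan (λ _ → 0) true) (Sphere.S (sphere t))
                                (Sphere.fan-odd (sphere t) (λ _ → 0))
    with _ , _ , (valid , adj) , (x , x∈) , (y , y∈) , _
           ← All.lookup (Sphere.simplices (sphere t)) σ∈S =
      (sequence x , [ valid⇒vertex x (valid x∈) ])
    , (sequence y , [ valid⇒vertex y (valid y∈) ])
    , adj⇒adjacent x y (valid x∈) (valid y∈) (adj x∈ y∈)

  W-chromatic-bound : ∀ t {m} → Colorable 1 (W s (2 + t)) m → 2 + t ≤ m
  W-chromatic-bound t {m} (c , size , proper) = ℕ.≰⇒> λ m≤1+t →
    too-few-colours f (λ {x} {y} → f-proper {x} {y}) (sphere t) (λ {x} → f<m {x}) m≤1+t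
    where
    open Graph (W s (2 + t)) using (Vertex)

    element : ∀ v → Nonempty (c v)
    element v with Subset.nonempty? (c v)
    ... | yes ne = ne
    ... | no ¬ne with () ← trans (sym (size v))
                     (trans (cong ∣_∣ (Subset.Empty-unique ¬ne)) (Subset.∣⊥∣≡0 m))

    f : Vec ℕ (2 + t) → ℕ
    f x with isVertex? s (2 + t) (sequence x)
    ... | yes v = toℕ (proj₁ (element (sequence x , [ v ])))
    -- `too-few-colours` takes a function on all vectors but constrains it on valid ones, so any
    -- default will do.
    ... | no  _ = 0

    vertex : ∀ {x} → Valid x → Vertex
    vertex {x} v = sequence x , [ valid⇒vertex x v ]

    f-valid : ∀ {x} (v : Valid x) → f x ≡ toℕ (proj₁ (element (vertex {x} v)))
    f-valid {x} v with isVertex? s (2 + t) (sequence x)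
    -- The decided proof and the given one form the same vertex, as vertices hold their proofs
    -- irrelevantly.
    ... | yes _ = refl
    ... | no ¬v = contradiction (valid⇒vertex x v) ¬v

    f<m : ∀ {x} → Valid x → f x < m
    f<m {x} v = subst (_< m) (sym (f-valid {x} v)) (Fin.toℕ<n (proj₁ (element (vertex {x} v))))

    f-proper : ∀ {x y} → Valid x → Valid y → Adj x y → f x ≢ f y
    f-proper {x} {y} v w x~y fx≡fy =
      proper (vertex {x} v) (vertex {y} w) (adj⇒adjacent x y v w x~y)
        (i , Subset.x∈p∩q⁺ (i∈v , subst (_∈ˢ c (vertex {y} w)) (sym i≡j) j∈w))
      where
      i   = proj₁ (element (vertex {x} v))
      i∈v = proj₂ (element (vertex {x} v))
      j   = proj₁ (element (vertex {y} w))
      j∈w = proj₂ (element (vertex {y} w))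
      i≡j : i ≡ j
      i≡j = Fin.toℕ-injective (trans (sym (f-valid {x} v)) (trans fx≡fy (f-valid {y} w)))

theorem2 : (s t : ℕ) .{{_ : NonZero s}} → t ≥ 2 →
    IsMultichromaticNumber s (W s t) (t + 2 * (s ∸ 1))
theorem2 (suc r) (suc (suc t)) (s≤s (s≤s z≤n)) =
    W-colorable r (2 + t)
  , λ _ → stahl-bound (W (suc r) (2 + t)) r (W-edge t) (W-chromatic-bound t)
  where open Coordinates r
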